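{- Let $k\equiv5\pmod{10}$. Then $\operatorname{Ker}\nu_{G^k}=\{M\in\Gamma_{\theta,5}: M\equiv\pm\begin{pmatrix}1&0\\0&1\end{pmatrix}\pmod5\}$.
   Context: $\Gamma_{\theta,5}=\{M\in SL(2,\mathbb{Z}): M\equiv\pm\begin{pmatrix}1&0\\0&1\end{pmatrix}\text{ or }\pm\begin{pmatrix}0&-1\\1&0\end{pmatrix}\pmod 5\}$. For $M=\begin{pmatrix} a&b\\ c&d\end{pmatrix}\in\Gamma_{\theta,5}$ define $g(M)=\frac{6b}{5}+\frac{2ab}{5}+\frac{2cd}{5}$ if $M\equiv I$, $\frac{24b}{5}+\frac{2ab}{5}+\frac{2cd}{5}$ if $M\equiv -I$, $5+\frac{6d}{5}+\frac{2ab}{5}+\frac{2cd}{5}$ if $M\equiv\begin{pmatrix}0&-1\\1&0\end{pmatrix}$, $5-\frac{6d}{5}+\frac{2ab}{5}+\frac{2cd}{5}$ if $M\equiv\begin{pmatrix}0&1\\-1&0\end{pmatrix}$ (all mod 5). For $k\in\mathbb{Z}$, $\nu_{G^k}(M)=\exp\!\left(\frac{\pi i k}{5}g(M)\right)$; this is the multiplier system of $G^k$, where $G(\tau)=\eta^6(\tau)/\big(\theta\begin{bmatrix}3/5\\3/5\end{bmatrix}(0,\tau)\theta\begin{bmatrix}3/5\\7/5\end{bmatrix}(0,\tau)\big)$, i.e. $G^k(M\tau)=\nu_{G^k}(M)(c\tau+d)^{2k}G^k(\tau)$. $\operatorname{Ker}\nu_{G^k}=\{M\in\Gamma_{\theta,5}:\nu_{G^k}(M)=1\}$.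 -}

module Defs where

open import Data.Integer as ℤ using (ℤ; +_)
import Data.Integer.Properties as ℤ
open import Data.Integer.Divisibility.Signed renaming (_∣_ to _∣ℤ_) using ()
open import Data.Nat as ℕ using (ℕ; zero; suc)
import Data.Nat.Properties as ℕ
open import Data.Product using (Σ; ∃; _×_; _,_; proj₁; proj₂)
open import Data.Rational
open import Data.Rational.Properties
import Data.Rational.Unnormalised as ℚᵘ
import Data.Rational.Unnormalised.Properties as ℚᵘ
open import Data.Rational.Solver using (module +-*-Solver)
open import Data.Sum using (_⊎_; inj₁; inj₂)
open import Level using (0ℓ)
open import Relation.Binary.PropositionalEquality
open import Relation.Nullary using (¬_)
open import Relation.Unary using (Pred)
open +-*-Solver using (solve; _:+_; _:*_; _:-_; :-_; _:=_; con)

------------------------------------------------------------------------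
-- Rational estimates

0≤∣_∣ : ∀ p → 0ℚ ≤ ∣ p ∣
0≤∣ p ∣ = nonNegative⁻¹ _ {{∣-∣-nonNeg p}}

+-0≤ : ∀ {p q} → 0ℚ ≤ p → 0ℚ ≤ q → 0ℚ ≤ p + q
+-0≤ = +-mono-≤ {0ℚ} {_} {0ℚ}

≤-+ʳ : ∀ {p q} → 0ℚ ≤ q → p ≤ p + q
≤-+ʳ {p} {q} 0≤q = subst (_≤ p + q) (+-identityʳ p) (+-monoʳ-≤ p 0≤q)

≤-+ˡ : ∀ {p q} → 0ℚ ≤ q → p ≤ q + p
≤-+ˡ {p} {q} 0≤q = subst (_≤ q + p) (+-identityˡ p) (+-monoˡ-≤ p 0≤q)

*-mono-≤ : ∀ {p q r s} → 0ℚ ≤ p → p ≤ q → 0ℚ ≤ r → r ≤ s → p * r ≤ q * s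
*-mono-≤ {p} {q} {r} {s} 0≤p p≤q 0≤r r≤s = ≤-trans
  (*-monoˡ-≤-nonNeg p {{nonNegative 0≤p}} r≤s)
  (*-monoʳ-≤-nonNeg s {{nonNegative (≤-trans 0≤r r≤s)}} p≤q)

*-0≤ : ∀ {p q} → 0ℚ ≤ p → 0ℚ ≤ q → 0ℚ ≤ p * q
*-0≤ {p} 0≤p 0≤q = subst (_≤ p * _) (*-zeroʳ p)
  (*-monoˡ-≤-nonNeg p {{nonNegative 0≤p}} 0≤q)

*-0< : ∀ {p q} → 0ℚ < p → 0ℚ < q → 0ℚ < p * q
*-0< {p} 0<p 0<q = subst (_< p * _) (*-zeroʳ p)
  (*-monoʳ-<-pos p {{positive 0<p}} 0<q)

half-0< : ∀ {ε} → 0ℚ < ε → 0ℚ < ½ * ε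
half-0< = *-0< (positive⁻¹ ½)

half+half : ∀ ε → ½ * ε + ½ * ε ≡ ε
half+half = solve 1 (λ e → con ½ :* e :+ con ½ :* e := e) refl

abstract
  -- B * δ ≡ ε has a positive solution δ.
  shrink : ∀ {B ε} → 0ℚ < B → 0ℚ < ε → ∃ λ δ → 0ℚ < δ × B * δ ≡ ε
  shrink {B} {ε} 0<B 0<ε = 1/B * ε , *-0< (positive⁻¹ 1/B {{1/pos⇒pos B}}) 0<ε , eq
    where
    instance
      B-pos : Positive B
      B-pos = positive 0<B
      B-nonZero : NonZero B
      B-nonZero = pos⇒nonZero B
    1/B : ℚ
    1/B = 1/ B
    eq : B * (1/B * ε) ≡ ε
    eq = trans (sym (*-assoc B 1/B ε))
      (trans (cong (_* ε) (*-inverseʳ B)) (*-identityˡ ε))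

∣p-q∣-sym : ∀ p q → ∣ p - q ∣ ≡ ∣ q - p ∣
∣p-q∣-sym p q = trans (sym (∣-p∣≡∣p∣ (p - q)))
  (cong ∣_∣ (solve 2 (λ p q → :- (p :- q) := q :- p) refl p q))

fromℕ : ℕ → ℚ
fromℕ n = + n / 1

toℚᵘ-/ : ∀ i n .{{_ : ℕ.NonZero n}} → toℚᵘ (i / n) ℚᵘ.≃ (i ℚᵘ./ n)
toℚᵘ-/ i (suc n) = toℚᵘ-fromℚᵘ (ℚᵘ.mkℚᵘ i n)

fromℕ-suc : ∀ n → fromℕ (suc n) ≡ 1ℚ + fromℕ n
fromℕ-suc n = toℚᵘ-injective (ℚᵘ.≃-trans (toℚᵘ-/ (+ suc n) 1)
  (ℚᵘ.≃-sym (ℚᵘ.≃-trans (toℚᵘ-homo-+ 1ℚ (fromℕ n))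
    (ℚᵘ.≃-trans (ℚᵘ.+-congʳ ℚᵘ.1ℚᵘ (toℚᵘ-/ (+ n) 1))
      (ℚᵘ.*≡* (cong (λ j → (+ 1 ℤ.+ j) ℤ.* + 1) (ℤ.*-identityʳ (+ n))))))))

/-inverse : ∀ n → (+ 1 / suc n) * fromℕ (suc n) ≡ 1ℚ
/-inverse n = toℚᵘ-injective (ℚᵘ.≃-trans
  (toℚᵘ-homo-* (+ 1 / suc n) (fromℕ (suc n)))
  (ℚᵘ.≃-trans (ℚᵘ.*-cong (toℚᵘ-/ (+ 1) (suc n)) (toℚᵘ-/ (+ suc n) 1))
    (ℚᵘ.*≡* (cong (λ m → + suc m) (trans (ℕ.*-identityʳ (n ℕ.+ 0)) 
      (trans (ℕ.+-identityʳ n) (sym (trans (ℕ.+-identityʳ (n ℕ.* 1)) (ℕ.*-identityʳ n)))))))))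

0≤1/ : ∀ n → 0ℚ ≤ + 1 / suc n
0≤1/ n = nonNegative⁻¹ _ {{normalize-nonNeg 1 (suc n)}}

fromℕ-0≤ : ∀ n → 0ℚ ≤ fromℕ n
fromℕ-0≤ n = nonNegative⁻¹ _ {{normalize-nonNeg n 1}}

fromℕ-mono : ∀ {m n} → m ℕ.≤ n → fromℕ m ≤ fromℕ n
fromℕ-mono {n = n} ℕ.z≤n = fromℕ-0≤ n
fromℕ-mono {suc m} {suc n} (ℕ.s≤s m≤n) =
  subst₂ _≤_ (sym (fromℕ-suc m)) (sym (fromℕ-suc n)) (+-monoʳ-≤ 1ℚ (fromℕ-mono m≤n))

archimedean : ∀ p → ∃ λ n → p ≤ fromℕ n
archimedean p@(mkℚ (+ n) d _) = n , toℚᵘ-cancel-≤ (ℚᵘ.≤-respʳ-≃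
  (ℚᵘ.≃-sym (toℚᵘ-/ (+ n) 1)) (ℚᵘ.*≤* (ℤ.*-monoˡ-≤-nonNeg (+ n) (ℤ.+≤+ (ℕ.s≤s ℕ.z≤n)))))
archimedean (mkℚ ℤ.-[1+ n ] d _) = 0 , *≤* ℤ.-≤+

------------------------------------------------------------------------
-- Real numbers as Cauchy sequences of rationals

record ℝ : Set where
  constructor mkℝ
  field
    approx : ℕ → ℚ
    cauchy : ∀ ε → 0ℚ < ε → ∃ λ N → ∀ m n → N ℕ.≤ m → N ℕ.≤ n →
             ∣ approx m - approx n ∣ ≤ ε
open ℝ public

infix  4 _≈ᴿ_ _<ᴿ_
infixl 6 _+ᴿ_ _-ᴿ_
infixl 7 _*ᴿ_

_≈ᴿ_ : ℝ → ℝ → Set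
x ≈ᴿ y = ∀ ε → 0ℚ < ε → ∃ λ N → ∀ n → N ℕ.≤ n → ∣ approx x n - approx y n ∣ ≤ ε

_<ᴿ_ : ℝ → ℝ → Set
x <ᴿ y = ∃ λ ε → 0ℚ < ε × ∃ λ N → ∀ n → N ℕ.≤ n → approx x n + ε ≤ approx y n

fromℚ : ℚ → ℝ
fromℚ q = mkℝ (λ _ → q) λ ε 0<ε → 0 , λ m n _ _ →
  subst (_≤ ε) (sym (cong ∣_∣ (+-inverseʳ q))) (<⇒≤ 0<ε)

abstract
  bounded : (x : ℝ) → ∃ λ B → 0ℚ < B × ∃ λ N → ∀ n → N ℕ.≤ n → ∣ approx x n ∣ ≤ B
  bounded x with cauchy x 1ℚ (positive⁻¹ 1ℚ)
  ... | N , close = ∣ approx x N ∣ + 1ℚ , +-mono-≤-< (0≤∣ approx x N ∣) (positive⁻¹ 1ℚ) ,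
    N , λ n N≤n → begin
      ∣ approx x n ∣                                  ≡⟨ cong ∣_∣ (split (approx x n) (approx x N)) ⟩
      ∣ approx x N + (approx x n - approx x N) ∣      ≤⟨ ∣p+q∣≤∣p∣+∣q∣ (approx x N) (approx x n - approx x N) ⟩
      ∣ approx x N ∣ + ∣ approx x n - approx x N ∣    ≤⟨ +-monoʳ-≤ ∣ approx x N ∣ (close n N N≤n ℕ.≤-refl) ⟩
      ∣ approx x N ∣ + 1ℚ                             ∎
    where
    open ≤-Reasoning
    split : ∀ p q → p ≡ q + (p - q)
    split = solve 2 (λ p q → p := q :+ (p :- q)) refl

_+ᴿ_ : ℝ → ℝ → ℝ
x +ᴿ y = mkℝ (λ n → approx x n + approx y n) proof
  where
  open ≤-Reasoning
  proof : ∀ ε → 0ℚ < ε → _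
  proof ε 0<ε with cauchy x (½ * ε) (half-0< 0<ε) | cauchy y (½ * ε) (half-0< 0<ε)
  ... | M , p | N , q = M ℕ.⊔ N , λ m n m≥ n≥ → begin
    ∣ (approx x m + approx y m) - (approx x n + approx y n) ∣
      ≡⟨ cong ∣_∣ (solve 4 (λ a b c d → (a :+ b) :- (c :+ d) := (a :- c) :+ (b :- d)) refl
           (approx x m) (approx y m) (approx x n) (approx y n)) ⟩
    ∣ (approx x m - approx x n) + (approx y m - approx y n) ∣
      ≤⟨ ∣p+q∣≤∣p∣+∣q∣ (approx x m - approx x n) (approx y m - approx y n) ⟩
    ∣ approx x m - approx x n ∣ + ∣ approx y m - approx y n ∣
      ≤⟨ +-mono-≤ (p m n (ℕ.m⊔n≤o⇒m≤o M N m≥) (ℕ.m⊔n≤o⇒m≤o M N n≥))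
                  (q m n (ℕ.m⊔n≤o⇒n≤o M N m≥) (ℕ.m⊔n≤o⇒n≤o M N n≥)) ⟩
    ½ * ε + ½ * ε ≡⟨ half+half ε ⟩
    ε ∎

-ᴿ_ : ℝ → ℝ
-ᴿ x = mkℝ (λ n → - approx x n) λ ε 0<ε →
  let N , close = cauchy x ε 0<ε in
  N , λ m n m≥ n≥ → subst (_≤ ε)
    (sym (trans (cong ∣_∣ (solve 2 (λ a b → (:- a) :- (:- b) := b :- a) refl
                    (approx x m) (approx x n)))
                (∣p-q∣-sym (approx x n) (approx x m))))
    (close m n m≥ n≥)

_-ᴿ_ : ℝ → ℝ → ℝ
x -ᴿ y = x +ᴿ (-ᴿ y)

*-close : ∀ {A B α β} a b c d → ∣ a ∣ ≤ A → ∣ d ∣ ≤ B → ∣ a - c ∣ ≤ β → ∣ b - d ∣ ≤ α →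
  ∣ a * b - c * d ∣ ≤ A * α + B * β
*-close {A} {B} {α} {β} a b c d a≤A d≤B a-c≤β b-d≤α = begin
  ∣ a * b - c * d ∣
    ≡⟨ cong ∣_∣ (split a b c d) ⟩
  ∣ a * (b - d) + d * (a - c) ∣
    ≤⟨ ∣p+q∣≤∣p∣+∣q∣ (a * (b - d)) (d * (a - c)) ⟩
  ∣ a * (b - d) ∣ + ∣ d * (a - c) ∣
    ≡⟨ cong₂ _+_ (∣p*q∣≡∣p∣*∣q∣ a (b - d)) (∣p*q∣≡∣p∣*∣q∣ d (a - c)) ⟩
  ∣ a ∣ * ∣ b - d ∣ + ∣ d ∣ * ∣ a - c ∣
    ≤⟨ +-mono-≤ (*-mono-≤ 0≤∣ a ∣ a≤A 0≤∣ b - d ∣ b-d≤α) (*-mono-≤ 0≤∣ d ∣ d≤B 0≤∣ a - c ∣ a-c≤β) ⟩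
  A * α + B * β ∎
  where
  open ≤-Reasoning
  split : ∀ a b c d → a * b - c * d ≡ a * (b - d) + d * (a - c)
  split = solve 4 (λ a b c d → a :* b :- c :* d := a :* (b :- d) :+ d :* (a :- c)) refl

_*ᴿ_ : ℝ → ℝ → ℝ
x *ᴿ y = mkℝ (λ n → approx x n * approx y n) λ ε 0<ε →
  let A , 0<A , N₁ , x≤A = bounded x
      B , 0<B , N₂ , y≤B = bounded y
      α , 0<α , Aα = shrink 0<A (half-0< 0<ε)
      β , 0<β , Bβ = shrink 0<B (half-0< 0<ε)
      N₃ , x-close = cauchy x β 0<β
      N₄ , y-close = cauchy y α 0<α
      N₁₂ = N₁ ℕ.⊔ N₂
      N₃₄ = N₃ ℕ.⊔ N₄
  in N₁₂ ℕ.⊔ N₃₄ , λ m n m≥ n≥ →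
    let m≥₁₂ = ℕ.m⊔n≤o⇒m≤o N₁₂ N₃₄ m≥
        m≥₃₄ = ℕ.m⊔n≤o⇒n≤o N₁₂ N₃₄ m≥
        n≥₁₂ = ℕ.m⊔n≤o⇒m≤o N₁₂ N₃₄ n≥
        n≥₃₄ = ℕ.m⊔n≤o⇒n≤o N₁₂ N₃₄ n≥
    in ≤-trans
      (*-close (approx x m) (approx y m) (approx x n) (approx y n)
        (x≤A m (ℕ.m⊔n≤o⇒m≤o N₁ N₂ m≥₁₂)) (y≤B n (ℕ.m⊔n≤o⇒n≤o N₁ N₂ n≥₁₂))
        (x-close m n (ℕ.m⊔n≤o⇒m≤o N₃ N₄ m≥₃₄) (ℕ.m⊔n≤o⇒m≤o N₃ N₄ n≥₃₄))
        (y-close m n (ℕ.m⊔n≤o⇒n≤o N₃ N₄ m≥₃₄) (ℕ.m⊔n≤o⇒n≤o N₃ N₄ n≥₃₄)))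
      (≤-reflexive (trans (cong₂ _+_ Aα Bβ) (half+half ε)))

------------------------------------------------------------------------
-- Gaussian rationals and the partial sums of the exponential series

record ℚ[i] : Set where
  constructor _+i_
  field
    reᴳ imᴳ : ℚ
open ℚ[i] public

infix  5 _+i_
infixl 6 _+ᴳ_ _-ᴳ_
infixl 7 _*ᴳ_ _·ᴳ_

_+ᴳ_ _-ᴳ_ _*ᴳ_ : ℚ[i] → ℚ[i] → ℚ[i]
(a +i b) +ᴳ (c +i d) = (a + c) +i (b + d)
(a +i b) -ᴳ (c +i d) = (a - c) +i (b - d)
(a +i b) *ᴳ (c +i d) = (a * c - b * d) +i (a * d + b * c)

_·ᴳ_ : ℚ → ℚ[i] → ℚ[i]
q ·ᴳ (a +i b) = (q * a) +i (q * b)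

-- expTerm j z = z ^ j / j !   and   expSum n z = Σ_{j ≤ n} z ^ j / j !
expTerm : ℕ → ℚ[i] → ℚ[i]
expTerm zero    z = 1ℚ +i 0ℚ
expTerm (suc j) z = (+ 1 / suc j) ·ᴳ (expTerm j z *ᴳ z)

expSum : ℕ → ℚ[i] → ℚ[i]
expSum zero    z = expTerm zero z
expSum (suc n) z = expSum n z +ᴳ expTerm (suc n) z

‖_‖ : ℚ[i] → ℚ
‖ a +i b ‖ = ∣ a ∣ + ∣ b ∣

0≤‖_‖ : ∀ z → 0ℚ ≤ ‖ z ‖
0≤‖ a +i b ‖ = +-0≤ 0≤∣ a ∣ 0≤∣ b ∣

∣re∣≤‖_‖ : ∀ z → ∣ reᴳ z ∣ ≤ ‖ z ‖
∣re∣≤‖ a +i b ‖ = ≤-+ʳ {∣ a ∣} 0≤∣ b ∣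
∣im∣≤‖_‖ : ∀ z → ∣ imᴳ z ∣ ≤ ‖ z ‖
∣im∣≤‖ a +i b ‖ = ≤-+ˡ {∣ b ∣} 0≤∣ a ∣

‖+‖ : ∀ z w → ‖ z +ᴳ w ‖ ≤ ‖ z ‖ + ‖ w ‖
‖+‖ (a +i b) (c +i d) = ≤-trans (+-mono-≤ (∣p+q∣≤∣p∣+∣q∣ a c) (∣p+q∣≤∣p∣+∣q∣ b d))
  (≤-reflexive (solve 4 (λ a b c d → (a :+ c) :+ (b :+ d) := (a :+ b) :+ (c :+ d))
    refl (∣ a ∣) (∣ b ∣) (∣ c ∣) (∣ d ∣)))

‖*‖ : ∀ z w → ‖ z *ᴳ w ‖ ≤ ‖ z ‖ * ‖ w ‖
‖*‖ (a +i b) (c +i d) = begin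
  ∣ a * c - b * d ∣ + ∣ a * d + b * c ∣
    ≤⟨ +-mono-≤ (∣p-q∣≤∣p∣+∣q∣ (a * c) (b * d)) (∣p+q∣≤∣p∣+∣q∣ (a * d) (b * c)) ⟩
  (∣ a * c ∣ + ∣ b * d ∣) + (∣ a * d ∣ + ∣ b * c ∣)
    ≡⟨ cong₂ _+_ (cong₂ _+_ (∣p*q∣≡∣p∣*∣q∣ a c) (∣p*q∣≡∣p∣*∣q∣ b d))
                 (cong₂ _+_ (∣p*q∣≡∣p∣*∣q∣ a d) (∣p*q∣≡∣p∣*∣q∣ b c)) ⟩
  (∣ a ∣ * ∣ c ∣ + ∣ b ∣ * ∣ d ∣) + (∣ a ∣ * ∣ d ∣ + ∣ b ∣ * ∣ c ∣)
    ≡⟨ solve 4 (λ a b c d → (a :* c :+ b :* d) :+ (a :* d :+ b :* c) := (a :+ b) :* (c :+ d))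
         refl (∣ a ∣) (∣ b ∣) (∣ c ∣) (∣ d ∣) ⟩
  (∣ a ∣ + ∣ b ∣) * (∣ c ∣ + ∣ d ∣) ∎
  where open ≤-Reasoning

‖·‖ : ∀ q z → 0ℚ ≤ q → ‖ q ·ᴳ z ‖ ≡ q * ‖ z ‖
‖·‖ q (a +i b) 0≤q = trans
  (cong₂ _+_ (trans (∣p*q∣≡∣p∣*∣q∣ q a) (cong (_* ∣ a ∣) (0≤p⇒∣p∣≡p 0≤q)))
             (trans (∣p*q∣≡∣p∣*∣q∣ q b) (cong (_* ∣ b ∣) (0≤p⇒∣p∣≡p 0≤q))))
  (sym (*-distribˡ-+ q (∣ a ∣) (∣ b ∣)))

‖-‖-sym : ∀ z w → ‖ z -ᴳ w ‖ ≡ ‖ w -ᴳ z ‖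
‖-‖-sym (a +i b) (c +i d) = cong₂ _+_ (∣p-q∣-sym a c) (∣p-q∣-sym b d)

-- The real majorant: term K j = K ^ j / j !, sum K n = Σ_{j ≤ n} K ^ j / j !
term : ℚ → ℕ → ℚ
term K zero    = 1ℚ
term K (suc j) = (+ 1 / suc j) * (term K j * K)

sum : ℚ → ℕ → ℚ
sum K zero    = term K zero
sum K (suc n) = sum K n + term K (suc n)

module _ {K : ℚ} (0≤K : 0ℚ ≤ K) where
  open ≤-Reasoning

  0≤term : ∀ j → 0ℚ ≤ term K j
  0≤term zero    = nonNegative⁻¹ 1ℚ
  0≤term (suc j) = *-0≤ (0≤1/ j) (*-0≤ (0≤term j) 0≤K)

  0≤sum : ∀ n → 0ℚ ≤ sum K n
  0≤sum zero    = 0≤term zero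
  0≤sum (suc n) = +-0≤ (0≤sum n) (0≤term (suc n))

  fromℕ-term : ∀ j → fromℕ (suc j) * term K (suc j) ≡ term K j * K
  fromℕ-term j = trans
    (solve 3 (λ n u t → n :* (u :* t) := (u :* n) :* t) refl
      (fromℕ (suc j)) (+ 1 / suc j) (term K j * K))
    (trans (cong (_* (term K j * K)) (/-inverse j)) (*-identityˡ _))

  ‖expTerm‖ : ∀ j z → ‖ z ‖ ≤ K → ‖ expTerm j z ‖ ≤ term K j
  ‖expTerm‖ zero    z z≤K = ≤-refl
  ‖expTerm‖ (suc j) z z≤K = begin
    ‖ (+ 1 / suc j) ·ᴳ (expTerm j z *ᴳ z) ‖ ≡⟨ ‖·‖ (+ 1 / suc j) (expTerm j z *ᴳ z) (0≤1/ j) ⟩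
    (+ 1 / suc j) * ‖ expTerm j z *ᴳ z ‖
      ≤⟨ *-monoˡ-≤-nonNeg (+ 1 / suc j) {{nonNegative (0≤1/ j)}} (≤-trans (‖*‖ (expTerm j z) z)
           (*-mono-≤ 0≤‖ expTerm j z ‖ (‖expTerm‖ j z z≤K) 0≤‖ z ‖ z≤K)) ⟩
    (+ 1 / suc j) * (term K j * K) ∎

  -- The map z ↦ z ^ j / j ! has Lipschitz constant K ^ (j-1) / (j-1)!
  expTerm-lipschitz : ∀ j z w → ‖ z ‖ ≤ K → ‖ w ‖ ≤ K →
    ‖ expTerm (suc j) z -ᴳ expTerm (suc j) w ‖ ≤ term K j * ‖ z -ᴳ w ‖
  step : ∀ j z w → ‖ z ‖ ≤ K → ‖ w ‖ ≤ K →
    ‖ expTerm j z -ᴳ expTerm j w ‖ * K ≤ (fromℕ j * term K j) * ‖ z -ᴳ w ‖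
  step zero    z w _   _   = ≤-reflexive (trans (*-zeroˡ K)
    (sym (*-zeroˡ ‖ z -ᴳ w ‖)))
  step (suc j) z w z≤K w≤K = begin
    ‖ expTerm (suc j) z -ᴳ expTerm (suc j) w ‖ * K
      ≤⟨ *-monoʳ-≤-nonNeg K {{nonNegative 0≤K}} (expTerm-lipschitz j z w z≤K w≤K) ⟩
    (term K j * ‖ z -ᴳ w ‖) * K
      ≡⟨ solve 3 (λ t d k → (t :* d) :* k := (t :* k) :* d) refl (term K j) (‖ z -ᴳ w ‖) K ⟩
    (term K j * K) * ‖ z -ᴳ w ‖
      ≡⟨ cong (_* ‖ z -ᴳ w ‖) (sym (fromℕ-term j)) ⟩
    (fromℕ (suc j) * term K (suc j)) * ‖ z -ᴳ w ‖ ∎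
  expTerm-lipschitz j z w z≤K w≤K = begin
    ‖ u ·ᴳ (tz *ᴳ z) -ᴳ u ·ᴳ (tw *ᴳ w) ‖ ≡⟨ cong ‖_‖ (factor u tz z tw w) ⟩
    ‖ u ·ᴳ (tz *ᴳ (z -ᴳ w) +ᴳ (tz -ᴳ tw) *ᴳ w) ‖
      ≡⟨ ‖·‖ u (tz *ᴳ (z -ᴳ w) +ᴳ (tz -ᴳ tw) *ᴳ w) (0≤1/ j) ⟩
    u * ‖ tz *ᴳ (z -ᴳ w) +ᴳ (tz -ᴳ tw) *ᴳ w ‖
      ≤⟨ *-monoˡ-≤-nonNeg u {{nonNegative (0≤1/ j)}} inner ⟩
    u * (term K j * δ + (fromℕ j * term K j) * δ)
      ≡⟨ solve 4 (λ u t d n → u :* (t :* d :+ (n :* t) :* d) := (u :* (con 1ℚ :+ n)) :* (t :* d))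
           refl u (term K j) δ (fromℕ j) ⟩
    (u * (1ℚ + fromℕ j)) * (term K j * δ)
      ≡⟨ cong (λ n → (u * n) * (term K j * δ)) (sym (fromℕ-suc j)) ⟩
    (u * fromℕ (suc j)) * (term K j * δ)
      ≡⟨ trans (cong (_* (term K j * δ)) (/-inverse j)) (*-identityˡ _) ⟩
    term K j * δ ∎
    where
    u δ : ℚ
    u = + 1 / suc j
    δ = ‖ z -ᴳ w ‖
    tz tw : ℚ[i]
    tz = expTerm j z
    tw = expTerm j w
    inner : ‖ tz *ᴳ (z -ᴳ w) +ᴳ (tz -ᴳ tw) *ᴳ w ‖ ≤ term K j * δ + (fromℕ j * term K j) * δ
    inner = begin
      ‖ tz *ᴳ (z -ᴳ w) +ᴳ (tz -ᴳ tw) *ᴳ w ‖ ≤⟨ ‖+‖ (tz *ᴳ (z -ᴳ w)) ((tz -ᴳ tw) *ᴳ w) ⟩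
      ‖ tz *ᴳ (z -ᴳ w) ‖ + ‖ (tz -ᴳ tw) *ᴳ w ‖
        ≤⟨ +-mono-≤ (‖*‖ tz (z -ᴳ w)) (‖*‖ (tz -ᴳ tw) w) ⟩
      ‖ tz ‖ * δ + ‖ tz -ᴳ tw ‖ * ‖ w ‖
        ≤⟨ +-mono-≤
             (*-monoʳ-≤-nonNeg δ {{nonNegative 0≤‖ z -ᴳ w ‖}} (‖expTerm‖ j z z≤K))
             (*-monoˡ-≤-nonNeg (‖ tz -ᴳ tw ‖) {{nonNegative 0≤‖ tz -ᴳ tw ‖}} w≤K) ⟩
      term K j * δ + ‖ tz -ᴳ tw ‖ * K
        ≤⟨ +-monoʳ-≤ (term K j * δ) (step j z w z≤K w≤K) ⟩
      term K j * δ + (fromℕ j * term K j) * δ ∎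
    factor : ∀ u s z t w → u ·ᴳ (s *ᴳ z) -ᴳ u ·ᴳ (t *ᴳ w) ≡
                           u ·ᴳ (s *ᴳ (z -ᴳ w) +ᴳ (s -ᴳ t) *ᴳ w)
    factor u (s₁ +i s₂) (z₁ +i z₂) (t₁ +i t₂) (w₁ +i w₂) = cong₂ _+i_
      (trans (pull-minus u (s₁ * z₁) (s₂ * z₂) (t₁ * w₁) (t₂ * w₂))
        (cong (u *_) (trans (cong₂ _-_ (Δ s₁ z₁ t₁ w₁) (Δ s₂ z₂ t₂ w₂))
          (swap-minus (s₁ * (z₁ - w₁)) _ (s₂ * (z₂ - w₂)) _))))
      (trans (pull-plus u (s₁ * z₂) (s₂ * z₁) (t₁ * w₂) (t₂ * w₁))
        (cong (u *_) (trans (cong₂ _+_ (Δ s₁ z₂ t₁ w₂) (Δ s₂ z₁ t₂ w₁))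
          (swap-plus (s₁ * (z₂ - w₂)) _ (s₂ * (z₁ - w₁)) _))))
      where
      Δ : ∀ s z t w → s * z - t * w ≡ s * (z - w) + (s - t) * w
      Δ = solve 4 (λ s z t w → s :* z :- t :* w := s :* (z :- w) :+ (s :- t) :* w) refl
      pull-minus : ∀ u a b c d → u * (a - b) - u * (c - d) ≡ u * ((a - c) - (b - d))
      pull-minus = solve 5 (λ u a b c d →
        u :* (a :- b) :- u :* (c :- d) := u :* ((a :- c) :- (b :- d))) refl
      pull-plus : ∀ u a b c d → u * (a + b) - u * (c + d) ≡ u * ((a - c) + (b - d))
      pull-plus = solve 5 (λ u a b c d →
        u :* (a :+ b) :- u :* (c :+ d) := u :* ((a :- c) :+ (b :- d))) refl
      swap-minus : ∀ a b c d → (a + b) - (c + d) ≡ (a - c) + (b - d)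
      swap-minus = solve 4 (λ a b c d → (a :+ b) :- (c :+ d) := (a :- c) :+ (b :- d)) refl
      swap-plus : ∀ a b c d → (a + b) + (c + d) ≡ (a + c) + (b + d)
      swap-plus = solve 4 (λ a b c d → (a :+ b) :+ (c :+ d) := (a :+ c) :+ (b :+ d)) refl

  expSum-lipschitz : ∀ n z w → ‖ z ‖ ≤ K → ‖ w ‖ ≤ K →
    ‖ expSum n z -ᴳ expSum n w ‖ ≤ sum K n * ‖ z -ᴳ w ‖
  expSum-lipschitz n z w z≤K w≤K = ≤-trans (bound n)
    (*-monoʳ-≤-nonNeg δ {{nonNegative 0≤‖ z -ᴳ w ‖}}
      (≤-trans (≤-+ʳ {before n} (0≤term n)) (≤-reflexive (before+ n))))
    where
    δ : ℚ
    δ = ‖ z -ᴳ w ‖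
    -- Σ_{j < n} K ^ j / j !
    before : ℕ → ℚ
    before zero    = 0ℚ
    before (suc m) = sum K m
    before+ : ∀ m → before m + term K m ≡ sum K m
    before+ zero    = refl
    before+ (suc m) = refl
    regroup : ∀ a b c d → (a +ᴳ b) -ᴳ (c +ᴳ d) ≡ (a -ᴳ c) +ᴳ (b -ᴳ d)
    regroup (a +i a′) (b +i b′) (c +i c′) (d +i d′) = cong₂ _+i_ (eq a b c d) (eq a′ b′ c′ d′)
      where
      eq : ∀ a b c d → (a + b) - (c + d) ≡ (a - c) + (b - d)
      eq = solve 4 (λ a b c d → (a :+ b) :- (c :+ d) := (a :- c) :+ (b :- d)) refl
    bound : ∀ m → ‖ expSum m z -ᴳ expSum m w ‖ ≤ before m * δ
    bound zero    = ≤-reflexive (sym (*-zeroˡ δ))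
    bound (suc m) = begin
      ‖ (expSum m z +ᴳ expTerm (suc m) z) -ᴳ (expSum m w +ᴳ expTerm (suc m) w) ‖
        ≡⟨ cong ‖_‖ (regroup (expSum m z) (expTerm (suc m) z) (expSum m w) (expTerm (suc m) w)) ⟩
      ‖ (expSum m z -ᴳ expSum m w) +ᴳ (expTerm (suc m) z -ᴳ expTerm (suc m) w) ‖
        ≤⟨ ‖+‖ (expSum m z -ᴳ expSum m w) (expTerm (suc m) z -ᴳ expTerm (suc m) w) ⟩
      ‖ expSum m z -ᴳ expSum m w ‖ + ‖ expTerm (suc m) z -ᴳ expTerm (suc m) w ‖
        ≤⟨ +-mono-≤ (bound m) (expTerm-lipschitz m z w z≤K w≤K) ⟩
      before m * δ + term K m * δ
        ≡⟨ *-distribʳ-+ δ (before m) (term K m) ⟨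
      (before m + term K m) * δ
        ≡⟨ cong (_* δ) (before+ m) ⟩
      sum K m * δ ∎

  sum-mono : ∀ {m n} → m ℕ.≤′ n → sum K m ≤ sum K n
  sum-mono (ℕ.≤′-reflexive refl) = ≤-refl
  sum-mono (ℕ.≤′-step {n} m≤n)   = ≤-trans (sum-mono m≤n) (≤-+ʳ (0≤term (suc n)))

  ‖expSum-tail‖ : ∀ {m n} z → ‖ z ‖ ≤ K → m ℕ.≤′ n →
    ‖ expSum n z -ᴳ expSum m z ‖ ≤ sum K n - sum K m
  ‖expSum-tail‖ {m} z _ (ℕ.≤′-reflexive refl) = ≤-reflexive (trans
    (cong₂ (λ a b → ∣ a ∣ + ∣ b ∣) (+-inverseʳ (reᴳ (expSum m z))) (+-inverseʳ (imᴳ (expSum m z))))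
    (sym (+-inverseʳ (sum K m))))
  ‖expSum-tail‖ {m} z z≤K (ℕ.≤′-step {n} m≤n) = begin
    ‖ (expSum n z +ᴳ expTerm (suc n) z) -ᴳ expSum m z ‖
      ≡⟨ cong₂ (λ a b → ∣ a ∣ + ∣ b ∣)
           (swap (reᴳ (expSum n z)) (reᴳ (expTerm (suc n) z)) (reᴳ (expSum m z)))
           (swap (imᴳ (expSum n z)) (imᴳ (expTerm (suc n) z)) (imᴳ (expSum m z))) ⟩
    ‖ (expSum n z -ᴳ expSum m z) +ᴳ expTerm (suc n) z ‖
      ≤⟨ ‖+‖ (expSum n z -ᴳ expSum m z) (expTerm (suc n) z) ⟩
    ‖ expSum n z -ᴳ expSum m z ‖ + ‖ expTerm (suc n) z ‖
      ≤⟨ +-mono-≤ (‖expSum-tail‖ z z≤K m≤n) (‖expTerm‖ (suc n) z z≤K) ⟩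
    (sum K n - sum K m) + term K (suc n)
      ≡⟨ swap (sum K n) (term K (suc n)) (sum K m) ⟨
    sum K (suc n) - sum K m ∎
    where
    swap : ∀ a b c → (a + b) - c ≡ (a - c) + b
    swap = solve 3 (λ a b c → (a :+ b) :- c := (a :- c) :+ b) refl

  -- From index N ≥ 2K on, consecutive terms of the majorant at least halve.
  module _ (N : ℕ) (2K≤N : K + K ≤ fromℕ N) where

    term-halves : ∀ {j} → N ℕ.≤ j → term K (suc j) + term K (suc j) ≤ term K j
    term-halves {j} N≤j = begin
      u * (t * K) + u * (t * K)
        ≡⟨ solve 3 (λ u t k → u :* (t :* k) :+ u :* (t :* k) := (u :* t) :* (k :+ k)) refl u t K ⟩
      (u * t) * (K + K)
        ≤⟨ *-monoˡ-≤-nonNeg (u * t) {{nonNegative (*-0≤ (0≤1/ j) (0≤term j))}}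
             (≤-trans 2K≤N (fromℕ-mono (ℕ.m≤n⇒m≤1+n N≤j))) ⟩
      (u * t) * fromℕ (suc j)
        ≡⟨ solve 3 (λ u t n → (u :* t) :* n := (u :* n) :* t) refl u t (fromℕ (suc j)) ⟩
      (u * fromℕ (suc j)) * t ≡⟨ cong (_* t) (/-inverse j) ⟩
      1ℚ * t                  ≡⟨ *-identityˡ t ⟩
      t ∎
      where
      u t : ℚ
      u = + 1 / suc j
      t = term K j

    sum+term-anti : ∀ {m n} → N ℕ.≤ m → m ℕ.≤′ n → sum K n + term K n ≤ sum K m + term K m
    sum+term-anti N≤m (ℕ.≤′-reflexive refl) = ≤-refl
    sum+term-anti {m} N≤m (ℕ.≤′-step {n} m≤n) = begin
      (sum K n + term K (suc n)) + term K (suc n)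
        ≡⟨ +-assoc (sum K n) (term K (suc n)) (term K (suc n)) ⟩
      sum K n + (term K (suc n) + term K (suc n))
        ≤⟨ +-monoʳ-≤ (sum K n) (term-halves (ℕ.≤-trans N≤m (ℕ.≤′⇒≤ m≤n))) ⟩
      sum K n + term K n ≤⟨ sum+term-anti N≤m m≤n ⟩
      sum K m + term K m ∎

    sum-tail : ∀ {m n} → N ℕ.≤ m → m ℕ.≤′ n → sum K n - sum K m ≤ term K m
    sum-tail {m} {n} N≤m m≤n = begin
      sum K n - sum K m
        ≤⟨ +-monoˡ-≤ (- sum K m) (≤-trans (≤-+ʳ {sum K n} (0≤term n)) (sum+term-anti N≤m m≤n)) ⟩
      (sum K m + term K m) - sum K m
        ≡⟨ solve 2 (λ s t → (s :+ t) :- s := t) refl (sum K m) (term K m) ⟩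
      term K m ∎

    term-anti : ∀ {m n} → N ℕ.≤ m → m ℕ.≤′ n → term K n ≤ term K m
    term-anti N≤m (ℕ.≤′-reflexive refl) = ≤-refl
    term-anti N≤m (ℕ.≤′-step {n} m≤n) = ≤-trans
      (≤-trans (≤-+ʳ (0≤term (suc n))) (term-halves (ℕ.≤-trans N≤m (ℕ.≤′⇒≤ m≤n))))
      (term-anti N≤m m≤n)

    term→0 : ∀ ε → 0ℚ < ε → ∃ λ M → N ℕ.≤ M × ∀ n → M ℕ.≤ n → term K n ≤ ε
    term→0 ε 0<ε = suc (N ℕ.⊔ L) , ℕ.m≤n⇒m≤1+n (ℕ.m≤m⊔n N L) , small
      where
      instance
        ε-pos : Positive ε
        ε-pos = positive 0<ε
        ε-nonZero : NonZero ε
        ε-nonZero = pos⇒nonZero ε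
      D : ℚ
      D = term K N * K
      L : ℕ
      L = proj₁ (archimedean (D * 1/ ε))
      small : ∀ n → suc (N ℕ.⊔ L) ℕ.≤ n → term K n ≤ ε
      small (suc n) (ℕ.s≤s n≥) = begin
        term K (suc n)        ≡⟨⟩
        u * (term K n * K)
          ≤⟨ *-monoˡ-≤-nonNeg u {{nonNegative (0≤1/ n)}} (*-monoʳ-≤-nonNeg K {{nonNegative 0≤K}}
               (term-anti ℕ.≤-refl (ℕ.≤⇒≤′ (ℕ.m⊔n≤o⇒m≤o N L n≥)))) ⟩
        u * D ≡⟨ cong (u *_) (trans (sym (*-identityʳ D)) (trans (cong (D *_) (sym (*-inverseˡ ε)))
                   (sym (*-assoc D (1/ ε) ε)))) ⟩
        u * ((D * 1/ ε) * ε)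
          ≤⟨ *-monoˡ-≤-nonNeg u {{nonNegative (0≤1/ n)}} (*-monoʳ-≤-nonNeg ε {{pos⇒nonNeg ε}}
               (≤-trans (proj₂ (archimedean (D * 1/ ε)))
                 (fromℕ-mono (ℕ.m≤n⇒m≤1+n (ℕ.m⊔n≤o⇒n≤o N L n≥))))) ⟩
        u * (fromℕ (suc n) * ε) ≡⟨ *-assoc u (fromℕ (suc n)) ε ⟨
        (u * fromℕ (suc n)) * ε ≡⟨ trans (cong (_* ε) (/-inverse n)) (*-identityˡ ε) ⟩
        ε ∎
        where
        u : ℚ
        u = + 1 / suc n

  -- Along a Cauchy sequence bounded by K, the diagonal expSum n (z n) is Cauchy.
  expSum-cauchy : (z : ℕ → ℚ[i]) → (∃ λ N → ∀ n → N ℕ.≤ n → ‖ z n ‖ ≤ K) →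
    (∀ ε → 0ℚ < ε → ∃ λ N → ∀ m n → N ℕ.≤ m → N ℕ.≤ n → ‖ z m -ᴳ z n ‖ ≤ ε) →
    ∀ ε → 0ℚ < ε → ∃ λ N → ∀ m n → N ℕ.≤ m → N ℕ.≤ n →
      ‖ expSum m (z m) -ᴳ expSum n (z n) ‖ ≤ ε
  expSum-cauchy z (N₁ , z≤K) z-cauchy ε 0<ε with archimedean (K + K)
  ... | N₂ , 2K≤N₂ with shrink {sum K N₂ + term K N₂ + 1ℚ}
        (+-mono-≤-< {0ℚ} (+-0≤ (0≤sum N₂) (0≤term N₂)) (positive⁻¹ 1ℚ)) (half-0< 0<ε)
  ... | δ , 0<δ , Cδ with z-cauchy δ 0<δ | term→0 N₂ 2K≤N₂ (½ * ε) (half-0< 0<ε)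
  ... | N₃ , close | N₄ , N₂≤N₄ , small = N , both
    where
    N : ℕ
    N = N₁ ℕ.⊔ (N₃ ℕ.⊔ N₄)
    ≥N₁ : ∀ {n} → N ℕ.≤ n → N₁ ℕ.≤ n
    ≥N₁ = ℕ.m⊔n≤o⇒m≤o N₁ _
    ≥N₃ : ∀ {n} → N ℕ.≤ n → N₃ ℕ.≤ n
    ≥N₃ n≥ = ℕ.m⊔n≤o⇒m≤o N₃ N₄ (ℕ.m⊔n≤o⇒n≤o N₁ _ n≥)
    ≥N₄ : ∀ {n} → N ℕ.≤ n → N₄ ℕ.≤ n
    ≥N₄ n≥ = ℕ.m⊔n≤o⇒n≤o N₃ N₄ (ℕ.m⊔n≤o⇒n≤o N₁ _ n≥)
    C : ℚ
    C = sum K N₂ + term K N₂ + 1ℚ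
    sum≤C : ∀ {n} → N ℕ.≤ n → sum K n ≤ C
    sum≤C {n} n≥ = ≤-trans (≤-+ʳ {sum K n} (0≤term n)) (≤-trans
      (sum+term-anti N₂ 2K≤N₂ ℕ.≤-refl (ℕ.≤⇒≤′ (ℕ.≤-trans N₂≤N₄ (≥N₄ n≥))))
      (≤-+ʳ {sum K N₂ + term K N₂} (nonNegative⁻¹ 1ℚ)))
    ordered : ∀ {m n} → N ℕ.≤ m → m ℕ.≤ n → ‖ expSum n (z n) -ᴳ expSum m (z m) ‖ ≤ ε
    ordered {m} {n} m≥ m≤n = begin
      ‖ expSum n (z n) -ᴳ expSum m (z m) ‖
        ≡⟨ cong₂ (λ a b → ∣ a ∣ + ∣ b ∣)
             (via (reᴳ (expSum n (z n))) (reᴳ (expSum n (z m))) (reᴳ (expSum m (z m))))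
             (via (imᴳ (expSum n (z n))) (imᴳ (expSum n (z m))) (imᴳ (expSum m (z m)))) ⟩
      ‖ (expSum n (z n) -ᴳ expSum n (z m)) +ᴳ (expSum n (z m) -ᴳ expSum m (z m)) ‖
        ≤⟨ ‖+‖ (expSum n (z n) -ᴳ expSum n (z m)) (expSum n (z m) -ᴳ expSum m (z m)) ⟩
      ‖ expSum n (z n) -ᴳ expSum n (z m) ‖ + ‖ expSum n (z m) -ᴳ expSum m (z m) ‖
        ≤⟨ +-mono-≤
             (≤-trans (expSum-lipschitz n (z n) (z m) (z≤K n (≥N₁ n≥)) (z≤K m (≥N₁ m≥)))
               (*-mono-≤ (0≤sum n) (sum≤C n≥) 0≤‖ z n -ᴳ z m ‖ (close n m (≥N₃ n≥) (≥N₃ m≥))))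
             (≤-trans (‖expSum-tail‖ (z m) (z≤K m (≥N₁ m≥)) (ℕ.≤⇒≤′ m≤n))
               (≤-trans (sum-tail N₂ 2K≤N₂ (ℕ.≤-trans N₂≤N₄ (≥N₄ m≥)) (ℕ.≤⇒≤′ m≤n))
                 (small m (≥N₄ m≥)))) ⟩
      C * δ + ½ * ε       ≡⟨ cong (_+ ½ * ε) Cδ ⟩
      ½ * ε + ½ * ε       ≡⟨ half+half ε ⟩
      ε ∎
      where
      n≥ : N ℕ.≤ n
      n≥ = ℕ.≤-trans m≥ m≤n
      via : ∀ a b c → a - c ≡ (a - b) + (b - c)
      via = solve 3 (λ a b c → a :- c := (a :- b) :+ (b :- c)) refl
    both : ∀ m n → N ℕ.≤ m → N ℕ.≤ n → ‖ expSum m (z m) -ᴳ expSum n (z n) ‖ ≤ ε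
    both m n m≥ n≥ with ℕ.≤-total m n
    ... | inj₁ m≤n = subst (_≤ ε) (‖-‖-sym (expSum n (z n)) (expSum m (z m))) (ordered m≥ m≤n)
    ... | inj₂ n≤m = ordered n≥ n≤m

------------------------------------------------------------------------
-- Complex numbers

record ℂ : Set where
  constructor _+𝕚_
  field
    re im : ℝ
open ℂ public

infix  5 _+𝕚_
infix  4 _≈ᶜ_
infixl 7 _*ᶜ_

_≈ᶜ_ : ℂ → ℂ → Set
z ≈ᶜ w = (re z ≈ᴿ re w) × (im z ≈ᴿ im w)

_*ᶜ_ : ℂ → ℂ → ℂ
(a +𝕚 b) *ᶜ (c +𝕚 d) = (a *ᴿ c -ᴿ b *ᴿ d) +𝕚 (a *ᴿ d +ᴿ b *ᴿ c)

fromℝ : ℝ → ℂ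
fromℝ x = x +𝕚 fromℚ 0ℚ

1ᶜ 𝕚 : ℂ
1ᶜ = fromℝ (fromℚ 1ℚ)
𝕚  = fromℚ 0ℚ +𝕚 fromℚ 1ℚ

approxᶜ : ℂ → ℕ → ℚ[i]
approxᶜ z n = approx (re z) n +i approx (im z) n

approxᶜ-cauchy : ∀ z ε → 0ℚ < ε → ∃ λ N → ∀ m n → N ℕ.≤ m → N ℕ.≤ n →
  ‖ approxᶜ z m -ᴳ approxᶜ z n ‖ ≤ ε
approxᶜ-cauchy z ε 0<ε =
  let M , p = cauchy (re z) (½ * ε) (half-0< 0<ε)
      N , q = cauchy (im z) (½ * ε) (half-0< 0<ε)
  in M ℕ.⊔ N , λ m n m≥ n≥ → ≤-trans
    (+-mono-≤ (p m n (ℕ.m⊔n≤o⇒m≤o M N m≥) (ℕ.m⊔n≤o⇒m≤o M N n≥))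
              (q m n (ℕ.m⊔n≤o⇒n≤o M N m≥) (ℕ.m⊔n≤o⇒n≤o M N n≥)))
    (≤-reflexive (half+half ε))

abstract
  expApprox-cauchy : ∀ z ε → 0ℚ < ε → ∃ λ N → ∀ m n → N ℕ.≤ m → N ℕ.≤ n →
    ‖ expSum m (approxᶜ z m) -ᴳ expSum n (approxᶜ z n) ‖ ≤ ε
  expApprox-cauchy z =
    let A , 0<A , N₁ , x≤A = bounded (re z)
        B , 0<B , N₂ , y≤B = bounded (im z)
    in expSum-cauchy {A + B} (+-0≤ (<⇒≤ 0<A) (<⇒≤ 0<B)) (approxᶜ z)
      (N₁ ℕ.⊔ N₂ , λ n n≥ → +-mono-≤ (x≤A n (ℕ.m⊔n≤o⇒m≤o N₁ N₂ n≥)) (y≤B n (ℕ.m⊔n≤o⇒n≤o N₁ N₂ n≥)))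
      (approxᶜ-cauchy z)

-- The n-th approximation to exp z is Σ_{j ≤ n} z_n ^ j / j ! where z_n is the
-- n-th approximation to z. As z_n is bounded, the tails of these sums are
-- uniformly small, so the diagonal converges to the sum of the series at z.
exp : ℂ → ℂ
exp z = mkℝ (λ n → reᴳ (partial n)) (λ ε 0<ε →
          let N , close = expApprox-cauchy z ε 0<ε in
          N , λ m n m≥ n≥ → ≤-trans ∣re∣≤‖ partial m -ᴳ partial n ‖ (close m n m≥ n≥))
     +𝕚 mkℝ (λ n → imᴳ (partial n)) (λ ε 0<ε →
          let N , close = expApprox-cauchy z ε 0<ε in
          N , λ m n m≥ n≥ → ≤-trans ∣im∣≤‖ partial m -ᴳ partial n ‖ (close m n m≥ n≥))
  where
  partial : ℕ → ℚ[i]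
  partial n = expSum n (approxᶜ z n)

cos : ℝ → ℝ
cos x = re (exp (𝕚 *ᶜ fromℝ x))

-- π is twice the least positive zero of cos; this determines π up to _≈ᴿ_.
record IsPi (π : ℝ) : Set where
  ½π : ℝ
  ½π = fromℚ ½ *ᴿ π
  field
    positive-π  : fromℚ 0ℚ <ᴿ π
    cos-½π      : cos ½π ≈ᴿ fromℚ 0ℚ
    least       : ∀ x → fromℚ 0ℚ <ᴿ x → x <ᴿ ½π → ¬ (cos x ≈ᴿ fromℚ 0ℚ)

------------------------------------------------------------------------
-- The group Γ_{θ,5} and the multiplier system of G ^ k

infix 4 _≡_[mod_] _≡ₘ_[mod_]

_≡_[mod_] : ℤ → ℤ → ℕ → Set
x ≡ y [mod n ] = + n ∣ℤ x ℤ.- y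

record Matrix : Set where
  constructor matrix
  field
    a b c d : ℤ

det : Matrix → ℤ
det (matrix a b c d) = a ℤ.* d ℤ.- b ℤ.* c

-ₘ_ : Matrix → Matrix
-ₘ matrix a b c d = matrix (ℤ.- a) (ℤ.- b) (ℤ.- c) (ℤ.- d)

_≡ₘ_[mod_] : Matrix → Matrix → ℕ → Set
matrix a b c d ≡ₘ matrix a′ b′ c′ d′ [mod n ] =
  (a ≡ a′ [mod n ]) × (b ≡ b′ [mod n ]) × (c ≡ c′ [mod n ]) × (d ≡ d′ [mod n ])

I S : Matrix
I = matrix (+ 1) (+ 0) (+ 0) (+ 1)
S = matrix (+ 0) (ℤ.- + 1) (+ 1) (+ 0)

-- The four cases are mutually exclusive.
data ResidueClass (M : Matrix) : Set where
  ≡+I : M ≡ₘ I [mod 5 ]    → ResidueClass M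
  ≡-I : M ≡ₘ -ₘ I [mod 5 ] → ResidueClass M
  ≡+S : M ≡ₘ S [mod 5 ]    → ResidueClass M
  ≡-S : M ≡ₘ -ₘ S [mod 5 ] → ResidueClass M

record Γθ₅ : Set where
  field
    mat     : Matrix
    det≡1   : det mat ≡ + 1
    residue : ResidueClass mat
open Γθ₅ public

g : Γθ₅ → ℚ
g M with mat M | residue M
... | matrix a b c d | ≡+I _ =
        (+ 6 ℤ.* b) / 5 + (+ 2 ℤ.* a ℤ.* b) / 5 + (+ 2 ℤ.* c ℤ.* d) / 5
... | matrix a b c d | ≡-I _ =
        (+ 24 ℤ.* b) / 5 + (+ 2 ℤ.* a ℤ.* b) / 5 + (+ 2 ℤ.* c ℤ.* d) / 5
... | matrix a b c d | ≡+S _ =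
        + 5 / 1 + (+ 6 ℤ.* d) / 5 + (+ 2 ℤ.* a ℤ.* b) / 5 + (+ 2 ℤ.* c ℤ.* d) / 5
... | matrix a b c d | ≡-S _ =
        + 5 / 1 - (+ 6 ℤ.* d) / 5 + (+ 2 ℤ.* a ℤ.* b) / 5 + (+ 2 ℤ.* c ℤ.* d) / 5

-- ν_{G^k}(M) = exp ((π i k / 5) g(M))
ν : ℝ → ℤ → Γθ₅ → ℂ
ν π k M = exp (fromℝ π *ᶜ 𝕚 *ᶜ fromℝ (fromℚ (k / 5)) *ᶜ fromℝ (fromℚ (g M)))

Ker : (Γθ₅ → ℂ) → Pred Γθ₅ 0ℓ
Ker χ M = χ M ≈ᶜ 1ᶜ

{-# OPTIONS --safe #-}

-- Write e c for exp (c π i).  From cos (π / 2) = 0 we get e ½ + e (- ½) = 2 cos (π / 2) = 0,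
-- so multiplying by e (c + ½) gives e (c + 1) + e c = 0.  With e 0 = 1 this evaluates e at all
-- integers as ± 1 according to parity.  On ± I the entries b and c are divisible by 5 and g M is
-- an even integer; on ± S the entries a and d are divisible by 5 and g M is an odd integer.  As
-- k / 5 is an odd integer, ν M = e ((k / 5) * g M) is 1 in the first case and - 1 in the second.
--
-- The identity e c * e d = e (c + d) holds for partial sums up to a null sequence: the terms of
-- the product of two partial sums that are missing from the partial sum of the product are
-- bounded by the same terms for the real majorants, which lie in a tail of their product series.
module Submission where

open import Algebra.Bundles using (CommutativeRing; CommutativeSemiring)
open import Data.Nat as ℕ using (ℕ; zero; suc)

-- Cauchy products in a commutative semiring

module CauchyProduct {c ℓ} (R : CommutativeSemiring c ℓ) where
  open CommutativeSemiring R
  open import Algebra.Properties.Semiring.Mult semiring using (_×_)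
  open import Algebra.Solver.Ring.NaturalCoefficients.Default R
  open import Relation.Binary.Reasoning.Setoid setoid

  partialSum : ℕ → (ℕ → Carrier) → Carrier
  partialSum zero    a = a 0
  partialSum (suc n) a = partialSum n a + a (suc n)

  shift : (ℕ → Carrier) → ℕ → Carrier
  shift a j = a (suc j)

  -- Peeling off the first term of `a` leaves `b` fixed, so every induction below replaces `a` by
  -- `shift a`.
  convolution : (ℕ → Carrier) → (ℕ → Carrier) → ℕ → Carrier
  convolution a b zero    = a 0 * b 0
  convolution a b (suc n) = a 0 * b (suc n) + convolution (shift a) b n

  -- excess a b n = Σ a i * b j over i, j ≤ n with i + j > n
  excess : (ℕ → Carrier) → (ℕ → Carrier) → ℕ → Carrier
  excess a b zero    = 0#
  excess a b (suc n) = excess (shift a) b n + partialSum n (shift a) * b (suc n)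

  partialSum-cong : ∀ {a b} → (∀ j → a j ≈ b j) → ∀ n → partialSum n a ≈ partialSum n b
  partialSum-cong a≈b zero    = a≈b 0
  partialSum-cong a≈b (suc n) = +-cong (partialSum-cong a≈b n) (a≈b (suc n))

  partialSum-shift : ∀ a n → partialSum (suc n) a ≈ a 0 + partialSum n (shift a)
  partialSum-shift a zero    = refl
  partialSum-shift a (suc n) = trans (+-congʳ (partialSum-shift a n)) (+-assoc _ _ _)

  -- The triangle i + j ≤ n + 1 consists of its row i = 0 and a triangle one size smaller, which
  -- belongs to `shift a`.
  partialSum-convolution : ∀ a b n → partialSum (suc n) (convolution a b) ≈
    a 0 * partialSum (suc n) b + partialSum n (convolution (shift a) b)
  partialSum-convolution a b zero =
    solve 4 (λ x y z w → x :* y :+ (x :* z :+ w :* y) := x :* (y :+ z) :+ w :* y)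
      refl (a 0) (b 0) (b 1) (a 1)
  partialSum-convolution a b (suc n) = trans (+-congʳ (partialSum-convolution a b n))
    (solve 5 (λ x s t y c → (x :* s :+ t) :+ (x :* y :+ c) := x :* (s :+ y) :+ (t :+ c)) refl
      (a 0) (partialSum (suc n) b) (partialSum n (convolution (shift a) b)) (b (suc (suc n)))
      (convolution (shift a) b (suc n)))

  -- The square i, j ≤ n splits into the triangle i + j ≤ n and its complement.
  partialSum-* : ∀ a b n →
    partialSum n a * partialSum n b ≈ partialSum n (convolution a b) + excess a b n
  partialSum-* a b zero    = sym (+-identityʳ _)
  partialSum-* a b (suc n) = begin
    partialSum (suc n) a * (B + y)
      ≈⟨ *-congʳ (partialSum-shift a n) ⟩
    (a 0 + A) * (B + y)
      ≈⟨ solve 4 (λ x A B y → (x :+ A) :* (B :+ y) := x :* (B :+ y) :+ A :* B :+ A :* y) refl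
           (a 0) A B y ⟩
    a 0 * (B + y) + A * B + A * y
      ≈⟨ +-congʳ (+-congˡ (partialSum-* (shift a) b n)) ⟩
    a 0 * (B + y) + (partialSum n (convolution (shift a) b) + excess (shift a) b n) + A * y
      ≈⟨ solve 4 (λ p q r s → p :+ (q :+ r) :+ s := (p :+ q) :+ (r :+ s)) refl
           (a 0 * (B + y)) (partialSum n (convolution (shift a) b)) (excess (shift a) b n) (A * y) ⟩
    (a 0 * (B + y) + partialSum n (convolution (shift a) b)) + excess a b (suc n)
      ≈⟨ +-congʳ (partialSum-convolution a b n) ⟨
    partialSum (suc n) (convolution a b) + excess a b (suc n) ∎
    where
    A B y : Carrier
    A = partialSum n (shift a)
    B = partialSum n b
    y = b (suc n)

  -- For s = 0 and a 0 = 1 this says a j = z ^ j / j !; the offset s makes the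
  -- property stable under shift.
  Exponential : Carrier → Carrier → (ℕ → Carrier) → Set ℓ
  Exponential s z a = ∀ j → (s + suc j × 1#) * a (suc j) ≈ a j * z

  Exponential-shift : ∀ {s z a} → Exponential s z a → Exponential (s + 1#) z (shift a)
  Exponential-shift a-exp j = trans (*-congʳ (+-assoc _ _ _)) (a-exp (suc j))

  -- In each summand a i * b j the weight s + n + 1 is (s + i) + j: the recurrence of `a` absorbs s
  -- + i and that of `b` absorbs j. At i = 0 there is no earlier term of `a`, so the weight s
  -- survives there as the boundary term.
  convolution-exponential : ∀ {s z w a b} → Exponential s z a → Exponential 0# w b → ∀ n →
    (s + suc n × 1#) * convolution a b (suc n) ≈
      convolution a b n * (z + w) + s * a 0 * b (suc n)
  convolution-exponential {s} {z} {w} {a} {b} a-exp b-exp zero = begin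
    (s + 1 × 1#) * (a 0 * b 1 + a 1 * b 0)
      ≈⟨ solve 6 (λ s u a₀ a₁ b₀ b₁ → (s :+ u) :* (a₀ :* b₁ :+ a₁ :* b₀) :=
           (s :* a₀ :* b₁ :+ a₀ :* ((con 0 :+ u) :* b₁)) :+ b₀ :* ((s :+ u) :* a₁)) refl
           s (1 × 1#) (a 0) (a 1) (b 0) (b 1) ⟩
    (s * a 0 * b 1 + a 0 * ((0# + 1 × 1#) * b 1)) + b 0 * ((s + 1 × 1#) * a 1)
      ≈⟨ +-cong (+-congˡ (*-congˡ (b-exp 0))) (*-congˡ (a-exp 0)) ⟩
    (s * a 0 * b 1 + a 0 * (b 0 * w)) + b 0 * (a 0 * z)
      ≈⟨ solve 6 (λ s a₀ b₀ b₁ z w → (s :* a₀ :* b₁ :+ a₀ :* (b₀ :* w)) :+ b₀ :* (a₀ :* z) :=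
           (a₀ :* b₀) :* (z :+ w) :+ s :* a₀ :* b₁) refl s (a 0) (b 0) (b 1) z w ⟩
    (a 0 * b 0) * (z + w) + s * a 0 * b 1 ∎
  convolution-exponential {s} {z} {w} {a} {b} a-exp b-exp (suc n) = begin
    (s + suc (suc n) × 1#) * (a 0 * y′ + C′)
      ≈⟨ solve 5 (λ s u a₀ y′ C′ → (s :+ (con 1 :+ u)) :* (a₀ :* y′ :+ C′) :=
           (s :* a₀ :* y′ :+ a₀ :* ((con 0 :+ (con 1 :+ u)) :* y′)) :+ ((s :+ con 1) :+ u) :* C′) refl
           s (suc n × 1#) (a 0) y′ C′ ⟩
    (s * a 0 * y′ + a 0 * ((0# + suc (suc n) × 1#) * y′)) + ((s + 1#) + suc n × 1#) * C′
      ≈⟨ +-cong (+-congˡ (*-congˡ (b-exp (suc n))))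
           (convolution-exponential (Exponential-shift a-exp) b-exp n) ⟩
    (s * a 0 * y′ + a 0 * (y * w)) + (C * (z + w) + (s + 1#) * a 1 * y)
      -- The boundary term of the induction hypothesis becomes `a 0 * z * y`, the part of
      -- `a 0 * y * (z + w)` still missing.
      ≈⟨ +-congˡ (+-congˡ (*-congʳ
           (trans (*-congʳ (+-congˡ (sym (+-identityʳ 1#)))) (a-exp 0)))) ⟩
    (s * a 0 * y′ + a 0 * (y * w)) + (C * (z + w) + a 0 * z * y)
      ≈⟨ solve 7 (λ s a₀ y y′ C z w →
           (s :* a₀ :* y′ :+ a₀ :* (y :* w)) :+ (C :* (z :+ w) :+ a₀ :* z :* y) :=
           (a₀ :* y :+ C) :* (z :+ w) :+ s :* a₀ :* y′) refl s (a 0) y y′ C z w ⟩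
    (a 0 * y + C) * (z + w) + s * a 0 * y′ ∎
    where
    C C′ y y′ : Carrier
    C  = convolution (shift a) b n
    C′ = convolution (shift a) b (suc n)
    y  = b (suc n)
    y′ = b (suc (suc n))

  module _ (recip : ℕ → Carrier) (recip-inverse : ∀ j → recip j * (suc j × 1#) ≈ 1#) where

    recip-solve : ∀ j {x y} → (0# + suc j × 1#) * x ≈ y → x ≈ recip j * y
    recip-solve j {x} {y} eq = begin
      x                            ≈⟨ *-identityˡ x ⟨
      1# * x                       ≈⟨ *-congʳ (recip-inverse j) ⟨
      recip j * (suc j × 1#) * x   ≈⟨ *-assoc _ _ _ ⟩
      recip j * (suc j × 1# * x)   ≈⟨ *-congˡ (trans (*-congʳ (sym (+-identityˡ _))) eq) ⟩
      recip j * y                  ∎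

    -- The factors `suc j × 1#` are invertible, so the recurrence determines each term from its
    -- predecessor.
    Exponential-unique : ∀ {z a b} → a 0 ≈ b 0 → Exponential 0# z a → Exponential 0# z b →
      ∀ j → a j ≈ b j
    Exponential-unique a₀≈b₀ a-exp b-exp zero    = a₀≈b₀
    Exponential-unique a₀≈b₀ a-exp b-exp (suc j) = trans (recip-solve j (a-exp j))
      (trans (*-congˡ (*-congʳ (Exponential-unique a₀≈b₀ a-exp b-exp j)))
        (sym (recip-solve j (b-exp j))))

    -- This is the binomial theorem in the form Σ z^i / i! * w^j / j! = (z + w)^n / n! over i + j =
    -- n: for s = 0 the boundary term vanishes and the convolution satisfies the recurrence of z +
    -- w.
    convolution-unique : ∀ {z w a b c} → a 0 ≈ 1# → b 0 ≈ 1# → c 0 ≈ 1# →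
      Exponential 0# z a → Exponential 0# w b → Exponential 0# (z + w) c →
      ∀ j → convolution a b j ≈ c j
    convolution-unique {z} {w} {a} {b} a₀ b₀ c₀ a-exp b-exp c-exp = Exponential-unique
      (trans (*-cong a₀ b₀) (trans (*-identityˡ 1#) (sym c₀)))
      (λ n → trans (convolution-exponential a-exp b-exp n)
        (trans (+-congˡ (trans (*-congʳ (zeroˡ (a 0))) (zeroˡ _))) (+-identityʳ _)))
      c-exp

open import Defs
import Algebra.Properties.Semiring.Mult as Mult
import Algebra.Structures.Biased as Biased
open import Data.Integer as ℤ using (ℤ; +_; -[1+_])
import Data.Integer.Properties as ℤ
open import Data.Integer.Divisibility.Signed using (divides)
open import Data.Integer.Tactic.RingSolver using () renaming (solve-∀ to ℤ-solve-∀)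
import Data.Nat.Properties as ℕ
open import Data.Product using (∃; _×_; _,_)
open import Data.Rational
open import Data.Rational.Properties
import Data.Rational.Unnormalised as ℚᵘ
import Data.Rational.Unnormalised.Properties as ℚᵘ
open import Data.Rational.Solver using (module +-*-Solver)
open import Data.Sum using (_⊎_; inj₁; inj₂)
open import Level using (0ℓ)
open import Relation.Binary.PropositionalEquality
open import Relation.Binary.PropositionalEquality.Algebra using (isMagma)
open import Relation.Nullary using (¬_; contradiction)
open import Relation.Unary using (_≐_)

open +-*-Solver using (solve; _:+_; _:*_; _:-_; :-_; _:=_; con)

-- Gaussian rationals and the exponential series

0ᴳ 1ᴳ : ℚ[i]
0ᴳ = 0ℚ +i 0ℚ
1ᴳ = 1ℚ +i 0ℚ

ℚ-semiring : CommutativeSemiring 0ℓ 0ℓ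
ℚ-semiring = CommutativeRing.commutativeSemiring +-*-commutativeRing

ℚ[i]-semiring : CommutativeSemiring 0ℓ 0ℓ
ℚ[i]-semiring = record
  { _≈_ = _≡_ ; _+_ = _+ᴳ_ ; _*_ = _*ᴳ_ ; 0# = 0ᴳ ; 1# = 1ᴳ
  ; isCommutativeSemiring = Biased.isCommutativeSemiringˡ record
    { +-isCommutativeMonoid = Biased.isCommutativeMonoidˡ record
      { isSemigroup = record
        { isMagma = isMagma _+ᴳ_
        ; assoc = λ { (a +i b) (c +i d) (e +i f) → cong₂ _+i_ (+-assoc a c e) (+-assoc b d f) } }
      ; identityˡ = λ { (a +i b) → cong₂ _+i_ (+-identityˡ a) (+-identityˡ b) }
      ; comm = λ { (a +i b) (c +i d) → cong₂ _+i_ (+-comm a c) (+-comm b d) } }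
    ; *-isCommutativeMonoid = Biased.isCommutativeMonoidˡ record
      { isSemigroup = record
        { isMagma = isMagma _*ᴳ_
        ; assoc = λ { (a +i b) (c +i d) (e +i f) → cong₂ _+i_
            (solve 6 (λ a b c d e f → (a :* c :- b :* d) :* e :- (a :* d :+ b :* c) :* f :=
              a :* (c :* e :- d :* f) :- b :* (c :* f :+ d :* e)) refl a b c d e f)
            (solve 6 (λ a b c d e f → (a :* c :- b :* d) :* f :+ (a :* d :+ b :* c) :* e :=
              a :* (c :* f :+ d :* e) :+ b :* (c :* e :- d :* f)) refl a b c d e f) } }
      ; identityˡ = λ { (a +i b) → cong₂ _+i_
            (solve 2 (λ a b → con 1ℚ :* a :- con 0ℚ :* b := a) refl a b)
            (solve 2 (λ a b → con 1ℚ :* b :+ con 0ℚ :* a := b) refl a b) }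
      ; comm = λ { (a +i b) (c +i d) → cong₂ _+i_
            (solve 4 (λ a b c d → a :* c :- b :* d := c :* a :- d :* b) refl a b c d)
            (solve 4 (λ a b c d → a :* d :+ b :* c := c :* b :+ d :* a) refl a b c d) } }
    ; distribʳ = λ { (e +i f) (a +i b) (c +i d) → cong₂ _+i_
            (solve 6 (λ a b c d e f → (a :+ c) :* e :- (b :+ d) :* f :=
              (a :* e :- b :* f) :+ (c :* e :- d :* f)) refl a b c d e f)
            (solve 6 (λ a b c d e f → (a :+ c) :* f :+ (b :+ d) :* e :=
              (a :* f :+ b :* e) :+ (c :* f :+ d :* e)) refl a b c d e f) }
    ; zeroˡ = λ { (a +i b) → cong₂ _+i_
            (solve 2 (λ a b → con 0ℚ :* a :- con 0ℚ :* b := con 0ℚ) refl a b)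
            (solve 2 (λ a b → con 0ℚ :* b :+ con 0ℚ :* a := con 0ℚ) refl a b) }
    }
  }


-- The same identities serve twice: over ℚ[i] for the series itself and over ℚ for its majorant.
module Q = CauchyProduct ℚ-semiring
module G = CauchyProduct ℚ[i]-semiring

open Mult (CommutativeSemiring.semiring ℚ-semiring) using () renaming (_×_ to _×ℚ_)
open Mult (CommutativeSemiring.semiring ℚ[i]-semiring) using () renaming (_×_ to _×ᴳ_)

×ℚ-1 : ∀ n → n ×ℚ 1ℚ ≡ fromℕ n
×ℚ-1 zero    = refl
×ℚ-1 (suc n) = trans (cong (λ q → 1ℚ + q) (×ℚ-1 n)) (sym (fromℕ-suc n))

×ᴳ-1 : ∀ n → n ×ᴳ 1ᴳ ≡ fromℕ n +i 0ℚ
×ᴳ-1 zero    = refl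
×ᴳ-1 (suc n) = trans (cong (λ q → 1ᴳ +ᴳ q) (×ᴳ-1 n)) (cong (_+i 0ℚ) (sym (fromℕ-suc n)))

partialSum-term : ∀ K n → Q.partialSum n (term K) ≡ sum K n
partialSum-term K zero    = refl
partialSum-term K (suc n) = cong (_+ term K (suc n)) (partialSum-term K n)

partialSum-expTerm : ∀ z n → G.partialSum n (λ j → expTerm j z) ≡ expSum n z
partialSum-expTerm z zero    = refl
partialSum-expTerm z (suc n) = cong (_+ᴳ expTerm (suc n) z) (partialSum-expTerm z n)

term-exponential : ∀ K → Q.Exponential 0ℚ K (term K)
term-exponential K j = trans (cong (_* term K (suc j)) (trans (+-identityˡ _) (×ℚ-1 (suc j))))
  (trans (solve 3 (λ n u t → n :* (u :* t) := (u :* n) :* t) refl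
      (fromℕ (suc j)) (+ 1 / suc j) (term K j * K))
    (trans (cong (_* (term K j * K)) (/-inverse j)) (*-identityˡ _)))

expTerm-exponential : ∀ z → G.Exponential 0ᴳ z (λ j → expTerm j z)
expTerm-exponential z j = trans
  (cong (_*ᴳ expTerm (suc j) z)
    (trans (CommutativeSemiring.+-identityˡ ℚ[i]-semiring _) (×ᴳ-1 (suc j))))
  (scale (expTerm j z *ᴳ z))
  where
  u n : ℚ
  u = + 1 / suc j
  n = fromℕ (suc j)
  cancel : ∀ a → (u * n) * a ≡ a
  cancel a = trans (cong (_* a) (/-inverse j)) (*-identityˡ a)
  scale : ∀ w → (n +i 0ℚ) *ᴳ (u ·ᴳ w) ≡ w
  scale (a +i b) = cong₂ _+i_
    (trans (solve 4 (λ u n a b → n :* (u :* a) :- con 0ℚ :* (u :* b) := (u :* n) :* a) refl u n a b)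
      (cancel a))
    (trans (solve 4 (λ u n a b → n :* (u :* b) :+ con 0ℚ :* (u :* a) := (u :* n) :* b) refl u n a b)
      (cancel b))

convolution-term : ∀ K L n → Q.convolution (term K) (term L) n ≡ term (K + L) n
convolution-term K L = Q.convolution-unique (λ j → + 1 / suc j)
  (λ j → trans (cong (λ q → (+ 1 / suc j) * q) (×ℚ-1 (suc j))) (/-inverse j)) refl refl refl
  (term-exponential K) (term-exponential L) (term-exponential (K + L))

convolution-expTerm : ∀ z w n →
  G.convolution (λ j → expTerm j z) (λ j → expTerm j w) n ≡ expTerm n (z +ᴳ w)
convolution-expTerm z w = G.convolution-unique (λ j → (+ 1 / suc j) +i 0ℚ) inverse refl refl refl
  (expTerm-exponential z) (expTerm-exponential w) (expTerm-exponential (z +ᴳ w))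
  where
  inverse : ∀ j → ((+ 1 / suc j) +i 0ℚ) *ᴳ (suc j ×ᴳ 1ᴳ) ≡ 1ᴳ
  inverse j = trans (cong (((+ 1 / suc j) +i 0ℚ) *ᴳ_) (×ᴳ-1 (suc j))) (cong₂ _+i_
    (trans (solve 2 (λ u n → u :* n :- con 0ℚ :* con 0ℚ := u :* n) refl
      (+ 1 / suc j) (fromℕ (suc j))) (/-inverse j))
    (solve 2 (λ u n → u :* con 0ℚ :+ con 0ℚ :* n := con 0ℚ) refl (+ 1 / suc j) (fromℕ (suc j))))

open ≤-Reasoning

-- Products of partial sums and their nonnegative majorants

private variable
  A B : ℕ → ℚ

module _ (0≤A : ∀ j → 0ℚ ≤ A j) where

  partialSum-0≤ : ∀ n → 0ℚ ≤ Q.partialSum n A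
  partialSum-0≤ zero    = 0≤A 0
  partialSum-0≤ (suc n) = +-0≤ (partialSum-0≤ n) (0≤A (suc n))

  partialSum-mono : ∀ {m n} → m ℕ.≤′ n → Q.partialSum m A ≤ Q.partialSum n A
  partialSum-mono (ℕ.≤′-reflexive refl) = ≤-refl
  partialSum-mono (ℕ.≤′-step {n} m≤n)   = ≤-trans (partialSum-mono m≤n) (≤-+ʳ (0≤A (suc n)))

convolution-0≤ : (∀ j → 0ℚ ≤ A j) → (∀ j → 0ℚ ≤ B j) → ∀ n → 0ℚ ≤ Q.convolution A B n
convolution-0≤ 0≤A 0≤B zero    = *-0≤ (0≤A 0) (0≤B 0)
convolution-0≤ 0≤A 0≤B (suc n) =
  +-0≤ (*-0≤ (0≤A 0) (0≤B (suc n))) (convolution-0≤ (λ j → 0≤A (suc j)) 0≤B n)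

head≤convolution : (∀ j → 0ℚ ≤ A j) → (∀ j → 0ℚ ≤ B j) → ∀ n → A 0 * B n ≤ Q.convolution A B n
head≤convolution 0≤A 0≤B zero    = ≤-refl
head≤convolution 0≤A 0≤B (suc n) = ≤-+ʳ (convolution-0≤ (λ j → 0≤A (suc j)) 0≤B n)

head*partialSum≤ : (∀ j → 0ℚ ≤ A j) → (∀ j → 0ℚ ≤ B j) → ∀ n →
  A 0 * Q.partialSum n B ≤ Q.partialSum n (Q.convolution A B)
head*partialSum≤ 0≤A 0≤B zero = ≤-refl
head*partialSum≤ {A} {B} 0≤A 0≤B (suc n) = begin
  A 0 * (Q.partialSum n B + B (suc n))          ≡⟨ *-distribˡ-+ (A 0) (Q.partialSum n B) (B (suc n)) ⟩
  A 0 * Q.partialSum n B + A 0 * B (suc n)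
    ≤⟨ +-mono-≤ (head*partialSum≤ 0≤A 0≤B n) (head≤convolution 0≤A 0≤B (suc n)) ⟩
  Q.partialSum (suc n) (Q.convolution A B) ∎

-- The rectangle i ≤ m, j ≤ n lies inside the triangle i + j ≤ m + n, and all terms are nonnegative.
partialSum-*-≤ : (∀ j → 0ℚ ≤ A j) → (∀ j → 0ℚ ≤ B j) → ∀ m n →
  Q.partialSum m A * Q.partialSum n B ≤ Q.partialSum (m ℕ.+ n) (Q.convolution A B)
partialSum-*-≤ 0≤A 0≤B zero n = head*partialSum≤ 0≤A 0≤B n
partialSum-*-≤ {A} {B} 0≤A 0≤B (suc m) n = begin
  Q.partialSum (suc m) A * T                     ≡⟨ cong (_* T) (Q.partialSum-shift A m) ⟩
  (A 0 + Q.partialSum m (Q.shift A)) * T         ≡⟨ *-distribʳ-+ T (A 0) (Q.partialSum m (Q.shift A)) ⟩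
  A 0 * T + Q.partialSum m (Q.shift A) * T
    ≤⟨ +-mono-≤
         (*-monoˡ-≤-nonNeg (A 0) {{nonNegative (0≤A 0)}}
           (partialSum-mono 0≤B (ℕ.≤⇒≤′ (ℕ.m≤n+m n (suc m)))))
         (partialSum-*-≤ (λ j → 0≤A (suc j)) 0≤B m n) ⟩
  A 0 * Q.partialSum (suc m ℕ.+ n) B + Q.partialSum (m ℕ.+ n) (Q.convolution (Q.shift A) B)
    ≡⟨ Q.partialSum-convolution A B (m ℕ.+ n) ⟨
  Q.partialSum (suc m ℕ.+ n) (Q.convolution A B) ∎
  where
  T : ℚ
  T = Q.partialSum n B

module _ {b : ℕ → ℚ[i]} (b≤B : ∀ j → ‖ b j ‖ ≤ B j) where

  ‖partialSum‖ : ∀ n → ‖ G.partialSum n b ‖ ≤ Q.partialSum n B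
  ‖partialSum‖ zero    = b≤B 0
  ‖partialSum‖ (suc n) = ≤-trans (‖+‖ (G.partialSum n b) (b (suc n)))
    (+-mono-≤ (‖partialSum‖ n) (b≤B (suc n)))

-- The excess is built without subtraction, so domination passes through its sums and products term
-- by term.
‖excess‖ : ∀ {a b A B} → (∀ j → ‖ a j ‖ ≤ A j) → (∀ j → ‖ b j ‖ ≤ B j) → ∀ n →
  ‖ G.excess a b n ‖ ≤ Q.excess A B n
‖excess‖ a≤A b≤B zero = ≤-refl
‖excess‖ {a} {b} a≤A b≤B (suc n) = ≤-trans
  (‖+‖ (G.excess (G.shift a) b n) (G.partialSum n (G.shift a) *ᴳ b (suc n)))
  (+-mono-≤ (‖excess‖ (λ j → a≤A (suc j)) b≤B n)
    (≤-trans (‖*‖ (G.partialSum n (G.shift a)) (b (suc n)))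
      (*-mono-≤ 0≤‖ G.partialSum n (G.shift a) ‖ (‖partialSum‖ (λ j → a≤A (suc j)) n)
        0≤‖ b (suc n) ‖ (b≤B (suc n)))))

-- The error is exactly the excess. Its majorant is at most the block of terms from n + 1 to 2n of
-- the series of K + L. From `N` on these terms at least halve, so the block is at most the term at
-- n.
expSum-* : ∀ {K L} → 0ℚ ≤ K → 0ℚ ≤ L → ∀ N → (K + L) + (K + L) ≤ fromℕ N → ∀ {n} → N ℕ.≤ n →
  ∀ z w → ‖ z ‖ ≤ K → ‖ w ‖ ≤ L →
  ‖ expSum n z *ᴳ expSum n w -ᴳ expSum n (z +ᴳ w) ‖ ≤ term (K + L) n
expSum-* {K} {L} 0≤K 0≤L N large {n} N≤n z w z≤K w≤L = begin
  ‖ expSum n z *ᴳ expSum n w -ᴳ expSum n (z +ᴳ w) ‖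
    ≡⟨ cong (λ p → ‖ p -ᴳ expSum n (z +ᴳ w) ‖) product ⟩
  ‖ (expSum n (z +ᴳ w) +ᴳ E) -ᴳ expSum n (z +ᴳ w) ‖
    ≡⟨ cong ‖_‖ (cancel (expSum n (z +ᴳ w)) E) ⟩
  ‖ E ‖
    ≤⟨ ‖excess‖ (λ j → ‖expTerm‖ 0≤K j z z≤K) (λ j → ‖expTerm‖ 0≤L j w w≤L) n ⟩
  Q.excess (term K) (term L) n
    ≡⟨ solve 2 (λ s e → e := (s :+ e) :- s) refl
         (Q.partialSum n (Q.convolution (term K) (term L))) (Q.excess (term K) (term L) n) ⟩
  (Q.partialSum n (Q.convolution (term K) (term L)) + Q.excess (term K) (term L) n)
    - Q.partialSum n (Q.convolution (term K) (term L))
    ≡⟨ cong₂ _-_ (sym (Q.partialSum-* (term K) (term L) n)) (sums n) ⟩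
  Q.partialSum n (term K) * Q.partialSum n (term L) - sum (K + L) n
    ≤⟨ +-monoˡ-≤ (- sum (K + L) n) (partialSum-*-≤ (0≤term 0≤K) (0≤term 0≤L) n n) ⟩
  Q.partialSum (n ℕ.+ n) (Q.convolution (term K) (term L)) - sum (K + L) n
    ≡⟨ cong (_- sum (K + L) n) (sums (n ℕ.+ n)) ⟩
  sum (K + L) (n ℕ.+ n) - sum (K + L) n
    ≤⟨ sum-tail (+-0≤ 0≤K 0≤L) N large N≤n (ℕ.≤⇒≤′ (ℕ.m≤m+n n n)) ⟩
  term (K + L) n ∎
  where
  E : ℚ[i]
  E = G.excess (λ j → expTerm j z) (λ j → expTerm j w) n
  sums : ∀ m → Q.partialSum m (Q.convolution (term K) (term L)) ≡ sum (K + L) m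
  sums m = trans (Q.partialSum-cong (convolution-term K L) m) (partialSum-term (K + L) m)
  product : expSum n z *ᴳ expSum n w ≡ expSum n (z +ᴳ w) +ᴳ E
  product = trans
    (sym (cong₂ _*ᴳ_ (partialSum-expTerm z n) (partialSum-expTerm w n)))
    (trans (G.partialSum-* (λ j → expTerm j z) (λ j → expTerm j w) n)
      (cong (_+ᴳ E) (trans (G.partialSum-cong (convolution-expTerm z w) n)
        (partialSum-expTerm (z +ᴳ w) n))))
  cancel : ∀ s e → (s +ᴳ e) -ᴳ s ≡ e
  cancel (s +i s′) (e +i e′) = cong₂ _+i_
    (solve 2 (λ s e → (s :+ e) :- s := e) refl s e) (solve 2 (λ s e → (s :+ e) :- s := e) refl s′ e′)

-- Value at zero, imaginary arguments and conjugation

expTerm-0 : ∀ j → expTerm (suc j) 0ᴳ ≡ 0ᴳ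
expTerm-0 j = cong₂ _+i_
  (solve 3 (λ u s t → u :* (s :* con 0ℚ :- t :* con 0ℚ) := con 0ℚ) refl
    (+ 1 / suc j) (reᴳ (expTerm j 0ᴳ)) (imᴳ (expTerm j 0ᴳ)))
  (solve 3 (λ u s t → u :* (s :* con 0ℚ :+ t :* con 0ℚ) := con 0ℚ) refl
    (+ 1 / suc j) (reᴳ (expTerm j 0ᴳ)) (imᴳ (expTerm j 0ᴳ)))

expSum-0 : ∀ n → expSum n 0ᴳ ≡ 1ᴳ
expSum-0 zero    = refl
expSum-0 (suc n) = cong₂ _+ᴳ_ (expSum-0 n) (expTerm-0 n)

real*i : ∀ x → (x +i 0ℚ) *ᴳ (0ℚ +i 1ℚ) ≡ 0ℚ +i x
real*i x = cong₂ _+i_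
  (solve 1 (λ x → x :* con 0ℚ :- con 0ℚ :* con 1ℚ := con 0ℚ) refl x)
  (solve 1 (λ x → x :* con 1ℚ :+ con 0ℚ :* con 0ℚ := x) refl x)

imaginary*real : ∀ x y → (0ℚ +i x) *ᴳ (y +i 0ℚ) ≡ 0ℚ +i (x * y)
imaginary*real x y = cong₂ _+i_
  (solve 2 (λ x y → con 0ℚ :* y :- x :* con 0ℚ := con 0ℚ) refl x y)
  (solve 2 (λ x y → con 0ℚ :* con 0ℚ :+ x :* y := x :* y) refl x y)

conj : ℚ[i] → ℚ[i]
conj (a +i b) = a +i (- b)

expTerm-conj : ∀ j z → expTerm j (conj z) ≡ conj (expTerm j z)
expTerm-conj zero    z = refl
expTerm-conj (suc j) z = trans (cong (λ w → (+ 1 / suc j) ·ᴳ (w *ᴳ conj z)) (expTerm-conj j z))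
  (conj-* (+ 1 / suc j) (expTerm j z) z)
  where
  conj-* : ∀ u z w → u ·ᴳ (conj z *ᴳ conj w) ≡ conj (u ·ᴳ (z *ᴳ w))
  conj-* u (a +i b) (c +i d) = cong₂ _+i_
    (solve 5 (λ u a b c d → u :* (a :* c :- (:- b) :* (:- d)) := u :* (a :* c :- b :* d))
      refl u a b c d)
    (solve 5 (λ u a b c d → u :* (a :* (:- d) :+ (:- b) :* c) := :- (u :* (a :* d :+ b :* c)))
      refl u a b c d)

expSum-conj : ∀ n z → expSum n (conj z) ≡ conj (expSum n z)
expSum-conj zero    z = refl
expSum-conj (suc n) z = trans (cong₂ _+ᴳ_ (expSum-conj n z) (expTerm-conj (suc n) z))
  (cong (reᴳ (expSum (suc n) z) +i_)
    (sym (neg-distrib-+ (imᴳ (expSum n z)) (imᴳ (expTerm (suc n) z)))))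

-- Null sequences of Gaussian rationals

-- A record does not unfold, which lets `f` be inferred from the type of a proof.
record Null (f : ℕ → ℚ[i]) : Set where
  constructor null
  field eventually : ∀ ε → 0ℚ < ε → ∃ λ N → ∀ n → N ℕ.≤ n → ‖ f n ‖ ≤ ε
open Null

EventuallyBounded : (ℕ → ℚ[i]) → Set
EventuallyBounded f = ∃ λ C → 0ℚ < C × ∃ λ N → ∀ n → N ℕ.≤ n → ‖ f n ‖ ≤ C

Null-cong : ∀ {f g} → (∀ n → f n ≡ g n) → Null f → Null g
Null-cong f≡g f→0 = null λ ε 0<ε →
  let N , small = eventually f→0 ε 0<ε
  in N , λ n n≥ → subst (λ z → ‖ z ‖ ≤ ε) (f≡g n) (small n n≥)

‖-‖ : ∀ z w → ‖ z -ᴳ w ‖ ≤ ‖ z ‖ + ‖ w ‖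
‖-‖ (a +i b) (c +i d) = ≤-trans (+-mono-≤ (∣p-q∣≤∣p∣+∣q∣ a c) (∣p-q∣≤∣p∣+∣q∣ b d))
  (≤-reflexive (solve 4 (λ a b c d → (a :+ c) :+ (b :+ d) := (a :+ b) :+ (c :+ d))
    refl (∣ a ∣) (∣ b ∣) (∣ c ∣) (∣ d ∣)))

-- Sums and differences obey the same triangle inequality and share this proof.
Null-lift₂ : ∀ (_∙_ : ℚ[i] → ℚ[i] → ℚ[i]) → (∀ z w → ‖ z ∙ w ‖ ≤ ‖ z ‖ + ‖ w ‖) →
  ∀ {f g} → Null f → Null g → Null (λ n → f n ∙ g n)
Null-lift₂ _∙_ ‖∙‖ {f} {g} f→0 g→0 = null λ ε 0<ε →
  let M , p = eventually f→0 (½ * ε) (half-0< 0<ε)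
      N , q = eventually g→0 (½ * ε) (half-0< 0<ε)
  in M ℕ.⊔ N , λ n n≥ → ≤-trans (‖∙‖ (f n) (g n))
    (≤-trans (+-mono-≤ (p n (ℕ.m⊔n≤o⇒m≤o M N n≥)) (q n (ℕ.m⊔n≤o⇒n≤o M N n≥)))
      (≤-reflexive (half+half ε)))

Null-+ : ∀ {f g} → Null f → Null g → Null (λ n → f n +ᴳ g n)
Null-+ = Null-lift₂ _+ᴳ_ ‖+‖

Null-- : ∀ {f g} → Null f → Null g → Null (λ n → f n -ᴳ g n)
Null-- = Null-lift₂ _-ᴳ_ ‖-‖

Null-* : ∀ {f g} → EventuallyBounded f → Null g → Null (λ n → f n *ᴳ g n)
Null-* {f} {g} (C , 0<C , M , f≤C) g→0 = null λ ε 0<ε →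
  let δ , 0<δ , Cδ = shrink 0<C 0<ε
      N , small = eventually g→0 δ 0<δ
  in M ℕ.⊔ N , λ n n≥ → ≤-trans (‖*‖ (f n) (g n))
    (≤-trans (*-mono-≤ 0≤‖ f n ‖ (f≤C n (ℕ.m⊔n≤o⇒m≤o M N n≥))
                       0≤‖ g n ‖ (small n (ℕ.m⊔n≤o⇒n≤o M N n≥)))
      (≤-reflexive Cδ))

-- Distinguishes the limits 1 and - 1, whose difference is this constant.
¬Null-1+1 : ¬ Null (λ _ → 1ᴳ +ᴳ 1ᴳ)
¬Null-1+1 1+1→0 with eventually 1+1→0 1ℚ (positive⁻¹ 1ℚ)
... | N , small with small N ℕ.≤-refl
... | *≤* (ℤ.+≤+ (ℕ.s≤s ()))

Null⇒≈ᶜ : ∀ {z w} → Null (λ n → approxᶜ z n -ᴳ approxᶜ w n) → z ≈ᶜ w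
Null⇒≈ᶜ {z} {w} z-w→0 =
  (λ ε 0<ε → let N , small = eventually z-w→0 ε 0<ε in
    N , λ n n≥ → ≤-trans ∣re∣≤‖ approxᶜ z n -ᴳ approxᶜ w n ‖ (small n n≥)) ,
  (λ ε 0<ε → let N , small = eventually z-w→0 ε 0<ε in
    N , λ n n≥ → ≤-trans ∣im∣≤‖ approxᶜ z n -ᴳ approxᶜ w n ‖ (small n n≥))

≈ᶜ⇒Null : ∀ {z w} → z ≈ᶜ w → Null (λ n → approxᶜ z n -ᴳ approxᶜ w n)
≈ᶜ⇒Null (re≈ , im≈) = null λ ε 0<ε →
  let M , p = re≈ (½ * ε) (half-0< 0<ε)
      N , q = im≈ (½ * ε) (half-0< 0<ε)
  in M ℕ.⊔ N , λ n n≥ → ≤-trans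
    (+-mono-≤ (p n (ℕ.m⊔n≤o⇒m≤o M N n≥)) (q n (ℕ.m⊔n≤o⇒n≤o M N n≥)))
    (≤-reflexive (half+half ε))

‖expSum‖ : ∀ {K} → 0ℚ ≤ K → ∀ n z → ‖ z ‖ ≤ K → ‖ expSum n z ‖ ≤ sum K n
‖expSum‖ {K} 0≤K n z z≤K = subst₂ (λ w s → ‖ w ‖ ≤ s) (partialSum-expTerm z n) (partialSum-term K n)
  (‖partialSum‖ (λ j → ‖expTerm‖ 0≤K j z z≤K) n)

-- The integers inside ℚ

fromℤ : ℤ → ℚ
fromℤ i = i / 1

fromℤ-+ : ∀ i j → fromℤ i + fromℤ j ≡ fromℤ (i ℤ.+ j)
fromℤ-+ i j = toℚᵘ-injective (ℚᵘ.≃-trans (toℚᵘ-homo-+ (fromℤ i) (fromℤ j))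
  (ℚᵘ.≃-trans (ℚᵘ.+-cong (toℚᵘ-/ i 1) (toℚᵘ-/ j 1))
    (ℚᵘ.≃-trans (ℚᵘ.*≡* (cross i j))
      (ℚᵘ.≃-sym (toℚᵘ-/ (i ℤ.+ j) 1)))))
  where
  cross : ∀ i j → (i ℤ.* + 1 ℤ.+ j ℤ.* + 1) ℤ.* + 1 ≡ (i ℤ.+ j) ℤ.* + 1
  cross = ℤ-solve-∀

fromℤ-* : ∀ i j → fromℤ i * fromℤ j ≡ fromℤ (i ℤ.* j)
fromℤ-* i j = toℚᵘ-injective (ℚᵘ.≃-trans (toℚᵘ-homo-* (fromℤ i) (fromℤ j))
  (ℚᵘ.≃-trans (ℚᵘ.*-cong (toℚᵘ-/ i 1) (toℚᵘ-/ j 1))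
    (ℚᵘ.≃-sym (toℚᵘ-/ (i ℤ.* j) 1))))

fromℤ-neg : ∀ i → - fromℤ i ≡ fromℤ (ℤ.- i)
fromℤ-neg i = toℚᵘ-injective (ℚᵘ.≃-trans (toℚᵘ-homo‿- (fromℤ i))
  (ℚᵘ.≃-trans (ℚᵘ.-‿cong (toℚᵘ-/ i 1)) (ℚᵘ.≃-sym (toℚᵘ-/ (ℤ.- i) 1))))

/-cancel-5 : ∀ {i} j → i ≡ j ℤ.* + 5 → i / 5 ≡ fromℤ j
/-cancel-5 {i} j i≡5j = toℚᵘ-injective (ℚᵘ.≃-trans (toℚᵘ-/ i 5)
  (ℚᵘ.≃-trans (ℚᵘ.*≡* (trans (ℤ.*-identityʳ i) i≡5j)) (ℚᵘ.≃-sym (toℚᵘ-/ j 1))))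

fromℤ-even-suc : ∀ i → fromℤ (+ 2 ℤ.* i) + (1ℚ + 1ℚ) ≡ fromℤ (+ 2 ℤ.* ℤ.suc i)
fromℤ-even-suc i = trans (fromℤ-+ (+ 2 ℤ.* i) (+ 2))
  (cong fromℤ (2i+2 i))
  where
  2i+2 : ∀ i → + 2 ℤ.* i ℤ.+ + 2 ≡ + 2 ℤ.* (+ 1 ℤ.+ i)
  2i+2 = ℤ-solve-∀

-- cis c approximates exp (c π i).
module _ (π : ℝ) where

  arg cis : ℚ → ℕ → ℚ[i]
  arg c n = 0ℚ +i (c * approx π n)
  cis c n = expSum n (arg c n)

  arg-bounded : ∀ c → ∃ λ K → 0ℚ ≤ K × ∃ λ N → ∀ n → N ℕ.≤ n → ‖ arg c n ‖ ≤ K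
  arg-bounded c =
    let B , 0<B , N , π≤B = bounded π
    in ∣ c ∣ * B , *-0≤ 0≤∣ c ∣ (<⇒≤ 0<B) , N , λ n n≥ → begin
      0ℚ + ∣ c * approx π n ∣   ≡⟨ +-identityˡ (∣ c * approx π n ∣) ⟩
      ∣ c * approx π n ∣        ≡⟨ ∣p*q∣≡∣p∣*∣q∣ c (approx π n) ⟩
      ∣ c ∣ * ∣ approx π n ∣    ≤⟨ *-monoˡ-≤-nonNeg (∣ c ∣) {{∣-∣-nonNeg c}} (π≤B n n≥) ⟩
      ∣ c ∣ * B                 ∎

  -- From `N` ≥ 2K on, a majorant sum plus its last term no longer increases, so the value at `N`
  -- bounds all later sums.
  cis-bounded : ∀ c → EventuallyBounded (cis c)
  cis-bounded c =
    let K , 0≤K , M , arg≤K = arg-bounded c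
        N , large = archimedean (K + K)
    -- The summand 1 makes the bound strictly positive.
    in sum K N + term K N + 1ℚ ,
       +-mono-≤-< {0ℚ} (+-0≤ (0≤sum 0≤K N) (0≤term 0≤K N)) (positive⁻¹ 1ℚ) ,
       M ℕ.⊔ N , λ n n≥ → begin
         ‖ cis c n ‖
           ≤⟨ ‖expSum‖ 0≤K n (arg c n) (arg≤K n (ℕ.m⊔n≤o⇒m≤o M N n≥)) ⟩
         sum K n
           ≤⟨ ≤-+ʳ (0≤term 0≤K n) ⟩
         sum K n + term K n
           ≤⟨ sum+term-anti 0≤K N large ℕ.≤-refl (ℕ.≤⇒≤′ (ℕ.m⊔n≤o⇒n≤o M N n≥)) ⟩
         sum K N + term K N
           ≤⟨ ≤-+ʳ (nonNegative⁻¹ 1ℚ) ⟩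
         sum K N + term K N + 1ℚ ∎

  cis-* : ∀ c d → Null (λ n → cis c n *ᴳ cis d n -ᴳ cis (c + d) n)
  cis-* c d = null λ ε 0<ε →
    let K , 0≤K , M₁ , c≤K = arg-bounded c
        L , 0≤L , M₂ , d≤L = arg-bounded d
        N , large = archimedean ((K + L) + (K + L))
        M , N≤M , small = term→0 (+-0≤ 0≤K 0≤L) N large ε 0<ε
        M₁₂ = M₁ ℕ.⊔ M₂
    in M₁₂ ℕ.⊔ M , λ n n≥ →
      let n≥₁₂ = ℕ.m⊔n≤o⇒m≤o M₁₂ M n≥
          n≥M  = ℕ.m⊔n≤o⇒n≤o M₁₂ M n≥
      in begin
        ‖ cis c n *ᴳ cis d n -ᴳ cis (c + d) n ‖
          ≡⟨ cong (λ y → ‖ cis c n *ᴳ cis d n -ᴳ expSum n (0ℚ +i y) ‖)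
               (*-distribʳ-+ (approx π n) c d) ⟩
        ‖ cis c n *ᴳ cis d n -ᴳ expSum n (arg c n +ᴳ arg d n) ‖
          ≤⟨ expSum-* 0≤K 0≤L N large (ℕ.≤-trans N≤M n≥M) (arg c n) (arg d n)
               (c≤K n (ℕ.m⊔n≤o⇒m≤o M₁ M₂ n≥₁₂)) (d≤L n (ℕ.m⊔n≤o⇒n≤o M₁ M₂ n≥₁₂)) ⟩
        term (K + L) n ≤⟨ small n n≥M ⟩
        ε ∎

  cis-0 : ∀ n → cis 0ℚ n ≡ 1ᴳ
  cis-0 n = trans (cong (λ y → expSum n (0ℚ +i y)) (*-zeroˡ (approx π n))) (expSum-0 n)

  -- The argument is purely imaginary, so negating it is conjugating it.
  cis-neg : ∀ c n → cis (- c) n ≡ conj (cis c n)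
  cis-neg c n = trans (cong (λ y → expSum n (0ℚ +i y)) (sym (neg-distribˡ-* c (approx π n))))
    (expSum-conj n (arg c n))

  -- An equality at every index and not only in the limit: complex multiplication acts index by
  -- index, and apart from π all factors are constant sequences.
  ν-cis : ∀ k M n → approxᶜ (ν π k M) n ≡ cis ((k / 5) * g M) n
  ν-cis k M n = cong (expSum n) (trans
    (cong (λ z → z *ᴳ (κ +i 0ℚ) *ᴳ (γ +i 0ℚ)) (real*i p)) (trans
    (cong (_*ᴳ (γ +i 0ℚ)) (imaginary*real p κ)) (trans
    (imaginary*real (p * κ) γ)
    (cong (0ℚ +i_) (solve 3 (λ p κ γ → p :* κ :* γ := κ :* γ :* p) refl p κ γ)))))
    where
    p κ γ : ℚ
    p = approx π n
    κ = k / 5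
    γ = g M

  -- Values at integers, from the zero of the cosine at π / 2

  module _ (cos-½π : cos (fromℚ ½ *ᴿ π) ≈ᴿ fromℚ 0ℚ) where

    -- A number plus its conjugate is twice its real part, here twice the approximation to cos (π /
    -- 2).
    cis-½+conj : Null (λ n → cis ½ n +ᴳ cis (- ½) n)
    cis-½+conj = null λ ε 0<ε →
      let N , small = cos-½π (½ * ε) (half-0< 0<ε)
      in N , λ n n≥ → begin
        ‖ cis ½ n +ᴳ cis (- ½) n ‖
          ≡⟨ cong (λ z → ‖ cis ½ n +ᴳ z ‖) (cis-neg ½ n) ⟩
        ‖ cis ½ n +ᴳ conj (cis ½ n) ‖
          ≡⟨ cong (λ y → ∣ r n + r n ∣ + ∣ y ∣) (+-inverseʳ (imᴳ (cis ½ n))) ⟩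
        ∣ r n + r n ∣ + 0ℚ
          ≡⟨ +-identityʳ _ ⟩
        ∣ r n + r n ∣
          ≤⟨ ∣p+q∣≤∣p∣+∣q∣ (r n) (r n) ⟩
        ∣ r n ∣ + ∣ r n ∣
          ≤⟨ +-mono-≤ (r-small n (small n n≥)) (r-small n (small n n≥)) ⟩
        ½ * ε + ½ * ε
          ≡⟨ half+half ε ⟩
        ε ∎
      where
      r : ℕ → ℚ
      r n = reᴳ (cis ½ n)
      r-small : ∀ n {δ} → ∣ approx (cos (fromℚ ½ *ᴿ π)) n - 0ℚ ∣ ≤ δ → ∣ r n ∣ ≤ δ
      -- `cos` multiplies by `𝕚` from the left, hence the commutativity before `real*i`.
      r-small n {δ} = subst (λ x → ∣ x ∣ ≤ δ)
        (trans (+-identityʳ _) (cong (λ z → reᴳ (expSum n z)) (trans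
          (CommutativeSemiring.*-comm ℚ[i]-semiring (0ℚ +i 1ℚ) ((½ * approx π n) +i 0ℚ))
          (real*i (½ * approx π n)))))

    -- In the limit, cis (c + 1) + cis c = cis (c + ½) * (cis ½ + cis (- ½)).
    half-turn : ∀ c → Null (λ n → cis (c + 1ℚ) n +ᴳ cis c n)
    -- Subtracting both errors of `cis-*` from the product with the null factor leaves the claimed
    -- sum exactly.
    half-turn c = Null-cong pointwise
      (Null-- (Null-- (Null-* {cis (c + ½)} (cis-bounded (c + ½)) cis-½+conj) (cis-* (c + ½) ½))
              (cis-* (c + ½) (- ½)))
      where
      regroup : ∀ x y z p q → (x *ᴳ (y +ᴳ z) -ᴳ (x *ᴳ y -ᴳ p)) -ᴳ (x *ᴳ z -ᴳ q) ≡ p +ᴳ q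
      regroup (x +i x′) (y +i y′) (z +i z′) (p +i p′) (q +i q′) = cong₂ _+i_
        (solve 8 (λ x x′ y y′ z z′ p q →
          ((x :* (y :+ z) :- x′ :* (y′ :+ z′)) :- ((x :* y :- x′ :* y′) :- p))
            :- ((x :* z :- x′ :* z′) :- q) := p :+ q) refl x x′ y y′ z z′ p q)
        (solve 8 (λ x x′ y y′ z z′ p q →
          ((x :* (y′ :+ z′) :+ x′ :* (y :+ z)) :- ((x :* y′ :+ x′ :* y) :- p))
            :- ((x :* z′ :+ x′ :* z) :- q) := p :+ q) refl x x′ y y′ z z′ p′ q′)
      pointwise : ∀ n → _ ≡ cis (c + 1ℚ) n +ᴳ cis c n
      pointwise n = trans
        (regroup (cis (c + ½) n) (cis ½ n) (cis (- ½) n)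
          (cis (c + ½ + ½) n) (cis (c + ½ + - ½) n))
        (cong₂ (λ s t → cis s n +ᴳ cis t n) (+-assoc c ½ ½)
          (trans (+-assoc c ½ (- ½)) (+-identityʳ c)))

    -- The half turns from c + 1 and from c share the term `cis (c + 1ℚ)`, which cancels in their
    -- difference.
    full-turn : ∀ c → Null (λ n → cis (c + (1ℚ + 1ℚ)) n -ᴳ cis c n)
    full-turn c = Null-cong
      (λ n → trans (regroup (cis (c + 1ℚ + 1ℚ) n) (cis (c + 1ℚ) n) (cis c n))
        (cong (λ s → cis s n -ᴳ cis c n) (+-assoc c 1ℚ 1ℚ)))
      (Null-- (half-turn (c + 1ℚ)) (half-turn c))
      where
      regroup : ∀ x y z → (x +ᴳ y) -ᴳ (y +ᴳ z) ≡ x -ᴳ z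
      regroup (x +i x′) (y +i y′) (z +i z′) = cong₂ _+i_
        (solve 3 (λ x y z → (x :+ y) :- (y :+ z) := x :- z) refl x y z)
        (solve 3 (λ x y z → (x :+ y) :- (y :+ z) := x :- z) refl x′ y′ z′)

    private
      Even : ℤ → Set
      Even i = Null (λ n → cis (fromℤ (+ 2 ℤ.* i)) n -ᴳ 1ᴳ)

      advance : ∀ i → Null (λ n → cis (fromℤ (+ 2 ℤ.* ℤ.suc i)) n -ᴳ cis (fromℤ (+ 2 ℤ.* i)) n)
      advance i = subst (λ c → Null (λ n → cis c n -ᴳ cis (fromℤ (+ 2 ℤ.* i)) n))
        (fromℤ-even-suc i) (full-turn (fromℤ (+ 2 ℤ.* i)))

      even-0 : Even (+ 0)
      even-0 = null λ ε 0<ε → 0 , λ n _ →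
        subst (λ z → ‖ z -ᴳ 1ᴳ ‖ ≤ ε) (sym (cis-0 n)) (<⇒≤ 0<ε)

      up : ∀ i → Even i → Even (ℤ.suc i)
      up i even = Null-cong
        (λ n → regroup (cis (fromℤ (+ 2 ℤ.* ℤ.suc i)) n) (cis (fromℤ (+ 2 ℤ.* i)) n) 1ᴳ)
        (Null-+ (advance i) even)
        where
        regroup : ∀ x y z → (x -ᴳ y) +ᴳ (y -ᴳ z) ≡ x -ᴳ z
        regroup (x +i x′) (y +i y′) (z +i z′) = cong₂ _+i_
          (solve 3 (λ x y z → (x :- y) :+ (y :- z) := x :- z) refl x y z)
          (solve 3 (λ x y z → (x :- y) :+ (y :- z) := x :- z) refl x′ y′ z′)

      down : ∀ i → Even (ℤ.suc i) → Even i
      down i even = Null-cong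
        (λ n → regroup (cis (fromℤ (+ 2 ℤ.* ℤ.suc i)) n) (cis (fromℤ (+ 2 ℤ.* i)) n) 1ᴳ)
        (Null-- even (advance i))
        where
        regroup : ∀ x y z → (x -ᴳ z) -ᴳ (x -ᴳ y) ≡ y -ᴳ z
        regroup (x +i x′) (y +i y′) (z +i z′) = cong₂ _+i_
          (solve 3 (λ x y z → (x :- z) :- (x :- y) := y :- z) refl x y z)
          (solve 3 (λ x y z → (x :- z) :- (x :- y) := y :- z) refl x′ y′ z′)

    -- Induction from 0 in both directions, a full turn at a time.
    cis-even : ∀ i → Null (λ n → cis (fromℤ (+ 2 ℤ.* i)) n -ᴳ 1ᴳ)
    cis-even (+ zero)     = even-0
    cis-even (+ suc n)    = up (+ n) (cis-even (+ n))
    -- `ℤ.suc -[1+ 0 ]` computes to `+ 0`, and below `ℤ.suc -[1+ suc n ]` to `-[1+ n ]`.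
    cis-even -[1+ zero ]  = down -[1+ 0 ] even-0
    cis-even -[1+ suc n ] = down -[1+ suc n ] (cis-even -[1+ n ])

    cis-odd : ∀ i → Null (λ n → cis (fromℤ (+ 1 ℤ.+ + 2 ℤ.* i)) n +ᴳ 1ᴳ)
    cis-odd i = Null-cong
      (λ n → trans (regroup (cis (fromℤ (+ 2 ℤ.* i) + 1ℚ) n) (cis (fromℤ (+ 2 ℤ.* i)) n) 1ᴳ)
        (cong (λ c → cis c n +ᴳ 1ᴳ) (trans (+-comm (fromℤ (+ 2 ℤ.* i)) 1ℚ)
          (fromℤ-+ (+ 1) (+ 2 ℤ.* i)))))
      (Null-- (half-turn (fromℤ (+ 2 ℤ.* i))) (cis-even i))
      where
      regroup : ∀ x y z → (x +ᴳ y) -ᴳ (y -ᴳ z) ≡ x +ᴳ z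
      regroup (x +i x′) (y +i y′) (z +i z′) = cong₂ _+i_
        (solve 3 (λ x y z → (x :+ y) :- (y :- z) := x :+ z) refl x y z)
        (solve 3 (λ x y z → (x :+ y) :- (y :- z) := x :+ z) refl x′ y′ z′)

    Ker-ν⇐even : ∀ {k M} i → (k / 5) * g M ≡ fromℤ (+ 2 ℤ.* i) → Ker (ν π k) M
    Ker-ν⇐even {k} {M} i eq = Null⇒≈ᶜ {ν π k M} {1ᶜ} (Null-cong
      (λ n → cong (_-ᴳ 1ᴳ) (sym (trans (ν-cis k M n) (cong (λ c → cis c n) eq))))
      (cis-even i))

    -- The sequence would tend to both - 1 and 1, making the constant 2 null.
    Ker-ν⇒¬odd : ∀ {k M} i → (k / 5) * g M ≡ fromℤ (+ 1 ℤ.+ + 2 ℤ.* i) → ¬ Ker (ν π k) M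
    Ker-ν⇒¬odd {k} {M} i eq ν≈1 = ¬Null-1+1 (Null-cong
      (λ n → trans (cong (λ z → (cis (fromℤ (+ 1 ℤ.+ + 2 ℤ.* i)) n +ᴳ 1ᴳ) -ᴳ (z -ᴳ 1ᴳ))
          (trans (ν-cis k M n) (cong (λ c → cis c n) eq)))
        (regroup (cis (fromℤ (+ 1 ℤ.+ + 2 ℤ.* i)) n) 1ᴳ))
      (Null-- (cis-odd i) (≈ᶜ⇒Null {ν π k M} {1ᶜ} ν≈1)))
      where
      regroup : ∀ x z → (x +ᴳ z) -ᴳ (x -ᴳ z) ≡ z +ᴳ z
      regroup (x +i x′) (z +i z′) = cong₂ _+i_
        (solve 2 (λ x z → (x :+ z) :- (x :- z) := z :+ z) refl x z)
        (solve 2 (λ x z → (x :+ z) :- (x :- z) := z :+ z) refl x′ z′)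

-- The parity of g

Diagonal : Matrix → Set
Diagonal A = (A ≡ₘ I [mod 5 ]) ⊎ (A ≡ₘ -ₘ I [mod 5 ])

quotient-5 : ∀ i → i ≡ + 0 [mod 5 ] → ∃ λ j → i ≡ j ℤ.* + 5
quotient-5 i (divides j eq) = j , trans (sym (ℤ.+-identityʳ i)) eq

1≢q*5 : ∀ q → ¬ (+ 1 ≡ q ℤ.* + 5)
1≢q*5 (+ zero)  ()
1≢q*5 (+ suc _) ()
1≢q*5 -[1+ _ ]  ()

factor-5 : ∀ r q → r ℤ.* + 5 ℤ.- q ℤ.* + 5 ≡ (r ℤ.- q) ℤ.* + 5
factor-5 = ℤ-solve-∀

-- Otherwise a ≡ ± 1 and a ≡ 0 would make 1 a multiple of 5. This rules out a conflict between the
-- residue class stored in a group element and a diagonal class assumed for it.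
diagonal⇒a≢0 : ∀ A → Diagonal A → ¬ (Matrix.a A ≡ + 0 [mod 5 ])
diagonal⇒a≢0 (matrix a _ _ _) diagonal a≡0 with quotient-5 a a≡0 | diagonal
... | r , a≡5r | inj₁ (divides q a-1≡5q , _) = 1≢q*5 (r ℤ.- q)
  (trans (1≡a-[a-1] a) (trans (cong₂ ℤ._-_ a≡5r a-1≡5q) (factor-5 r q)))
  where
  1≡a-[a-1] : ∀ a → + 1 ≡ a ℤ.- (a ℤ.- + 1)
  1≡a-[a-1] = ℤ-solve-∀
... | r , a≡5r | inj₂ (divides q a+1≡5q , _) = 1≢q*5 (q ℤ.- r)
  (trans (1≡[a+1]-a a) (trans (cong₂ ℤ._-_ a+1≡5q a≡5r) (factor-5 q r)))
  where
  1≡[a+1]-a : ∀ a → + 1 ≡ (a ℤ.+ + 1) ℤ.- a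
  1≡[a+1]-a = ℤ-solve-∀

/-scale-5 : ∀ m {x} y → x ≡ y ℤ.* + 5 → (m ℤ.* x) / 5 ≡ fromℤ (m ℤ.* y)
/-scale-5 m y x≡5y = /-cancel-5 (m ℤ.* y)
  (trans (cong (m ℤ.*_) x≡5y) (sym (ℤ.*-assoc m y (+ 5))))

-- Covers products that carry the multiple of 5 as middle factor; `/-scale-5` covers those that
-- carry it last.
/-scale₂-5 : ∀ m {x} y z → x ≡ y ℤ.* + 5 → (m ℤ.* x ℤ.* z) / 5 ≡ fromℤ (m ℤ.* y ℤ.* z)
/-scale₂-5 m y z x≡5y = /-cancel-5 (m ℤ.* y ℤ.* z)
  (trans (cong (λ x → m ℤ.* x ℤ.* z) x≡5y) (move-5 m y z))
  where
  move-5 : ∀ m y z → m ℤ.* (y ℤ.* + 5) ℤ.* z ≡ m ℤ.* y ℤ.* z ℤ.* + 5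
  move-5 = ℤ-solve-∀

fromℤ-sum₃ : ∀ i j k {l p q r} → p ≡ fromℤ i → q ≡ fromℤ j → r ≡ fromℤ k →
  i ℤ.+ j ℤ.+ k ≡ l → p + q + r ≡ fromℤ l
fromℤ-sum₃ i j k refl refl refl refl =
  trans (cong (_+ fromℤ k) (fromℤ-+ i j)) (fromℤ-+ (i ℤ.+ j) k)

-- Divisibility by 5 of b and c, or of a and d, makes every fraction in `g` an even integer; only
-- the summand 5 of the cases ± S is odd. The congruence for a is kept to contradict diagonality
-- later.
parity-g : ∀ M →
  (Diagonal (mat M) × ∃ λ i → g M ≡ fromℤ (+ 2 ℤ.* i)) ⊎
  ((Matrix.a (mat M) ≡ + 0 [mod 5 ]) × ∃ λ i → g M ≡ fromℤ (+ 1 ℤ.+ + 2 ℤ.* i))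
parity-g M with mat M | residue M
... | matrix a b c d | ≡+I p@(_ , b≡0 , c≡0 , _) =
  let b′ , b≡5b′ = quotient-5 b b≡0
      c′ , c≡5c′ = quotient-5 c c≡0
  -- The witness is half of `g M`.
  in inj₁ (inj₁ p , + 3 ℤ.* b′ ℤ.+ a ℤ.* b′ ℤ.+ c′ ℤ.* d , fromℤ-sum₃
       (+ 6 ℤ.* b′) (+ 2 ℤ.* a ℤ.* b′) (+ 2 ℤ.* c′ ℤ.* d)
       (/-scale-5 (+ 6) b′ b≡5b′)
       (/-scale-5 (+ 2 ℤ.* a) b′ b≡5b′)
       (/-scale₂-5 (+ 2) c′ d c≡5c′)
       (double a b′ c′ d))
  where
  double : ∀ a b c d → + 6 ℤ.* b ℤ.+ + 2 ℤ.* a ℤ.* b ℤ.+ + 2 ℤ.* c ℤ.* d ≡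
    + 2 ℤ.* (+ 3 ℤ.* b ℤ.+ a ℤ.* b ℤ.+ c ℤ.* d)
  double = ℤ-solve-∀
... | matrix a b c d | ≡-I p@(_ , b≡0 , c≡0 , _) =
  let b′ , b≡5b′ = quotient-5 b b≡0
      c′ , c≡5c′ = quotient-5 c c≡0
  in inj₁ (inj₂ p , + 12 ℤ.* b′ ℤ.+ a ℤ.* b′ ℤ.+ c′ ℤ.* d , fromℤ-sum₃
       (+ 24 ℤ.* b′) (+ 2 ℤ.* a ℤ.* b′) (+ 2 ℤ.* c′ ℤ.* d)
       (/-scale-5 (+ 24) b′ b≡5b′)
       (/-scale-5 (+ 2 ℤ.* a) b′ b≡5b′)
       (/-scale₂-5 (+ 2) c′ d c≡5c′)
       (double a b′ c′ d))
  where
  double : ∀ a b c d → + 24 ℤ.* b ℤ.+ + 2 ℤ.* a ℤ.* b ℤ.+ + 2 ℤ.* c ℤ.* d ≡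
    + 2 ℤ.* (+ 12 ℤ.* b ℤ.+ a ℤ.* b ℤ.+ c ℤ.* d)
  double = ℤ-solve-∀
... | matrix a b c d | ≡+S (a≡0 , _ , _ , d≡0) =
  let a′ , a≡5a′ = quotient-5 a a≡0
      d′ , d≡5d′ = quotient-5 d d≡0
  -- The leading 2 comes from 5 = 1 + 2 * 2.
  in inj₂ (a≡0 , + 2 ℤ.+ + 3 ℤ.* d′ ℤ.+ a′ ℤ.* b ℤ.+ c ℤ.* d′ , fromℤ-sum₃
       (+ 5 ℤ.+ + 6 ℤ.* d′) (+ 2 ℤ.* a′ ℤ.* b) (+ 2 ℤ.* c ℤ.* d′)
       (trans (cong (λ q → + 5 / 1 + q) (/-scale-5 (+ 6) d′ d≡5d′)) (fromℤ-+ (+ 5) (+ 6 ℤ.* d′)))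
       (/-scale₂-5 (+ 2) a′ b a≡5a′)
       (/-scale-5 (+ 2 ℤ.* c) d′ d≡5d′)
       (double+1 a′ b c d′))
  where
  double+1 : ∀ a b c d → + 5 ℤ.+ + 6 ℤ.* d ℤ.+ + 2 ℤ.* a ℤ.* b ℤ.+ + 2 ℤ.* c ℤ.* d ≡
    + 1 ℤ.+ + 2 ℤ.* (+ 2 ℤ.+ + 3 ℤ.* d ℤ.+ a ℤ.* b ℤ.+ c ℤ.* d)
  double+1 = ℤ-solve-∀
... | matrix a b c d | ≡-S (a≡0 , _ , _ , d≡0) =
  let a′ , a≡5a′ = quotient-5 a a≡0
      d′ , d≡5d′ = quotient-5 d d≡0
  in inj₂ (a≡0 , + 2 ℤ.- + 3 ℤ.* d′ ℤ.+ a′ ℤ.* b ℤ.+ c ℤ.* d′ , fromℤ-sum₃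
       (+ 5 ℤ.- + 6 ℤ.* d′) (+ 2 ℤ.* a′ ℤ.* b) (+ 2 ℤ.* c ℤ.* d′)
       (trans (cong (λ q → + 5 / 1 - q) (/-scale-5 (+ 6) d′ d≡5d′))
         (trans (cong (λ q → + 5 / 1 + q) (fromℤ-neg (+ 6 ℤ.* d′)))
           (fromℤ-+ (+ 5) (ℤ.- (+ 6 ℤ.* d′)))))
       (/-scale₂-5 (+ 2) a′ b a≡5a′)
       (/-scale-5 (+ 2 ℤ.* c) d′ d≡5d′)
       (double+1 a′ b c d′))
  where
  double+1 : ∀ a b c d → + 5 ℤ.- + 6 ℤ.* d ℤ.+ + 2 ℤ.* a ℤ.* b ℤ.+ + 2 ℤ.* c ℤ.* d ≡
    + 1 ℤ.+ + 2 ℤ.* (+ 2 ℤ.- + 3 ℤ.* d ℤ.+ a ℤ.* b ℤ.+ c ℤ.* d)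
  double+1 = ℤ-solve-∀

-- The kernel for k ≡ 5 modulo 10

mainTheorem10 : (π : ℝ) → IsPi π →
    (k : ℤ) → k ≡ + 5 [mod 10 ] →
    Ker (ν π k) ≐ (λ M → (mat M ≡ₘ I [mod 5 ]) ⊎ (mat M ≡ₘ -ₘ I [mod 5 ]))
mainTheorem10 π isPi k (divides q k-5≡10q) = (λ {M} → to M) , (λ {M} → from M)
  where
  cos-½π : cos (fromℚ ½ *ᴿ π) ≈ᴿ fromℚ 0ℚ
  cos-½π = IsPi.cos-½π isPi
  -- From k = 10q + 5, the quotient k / 5 is the odd integer 1 + 2q.
  m : ℤ
  m = + 1 ℤ.+ + 2 ℤ.* q
  k/5≡m : k / 5 ≡ fromℤ m
  k/5≡m = /-cancel-5 m (trans (k≡[k-5]+5 k) (trans (cong (ℤ._+ + 5) k-5≡10q) (10q+5 q)))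
    where
    k≡[k-5]+5 : ∀ k → k ≡ (k ℤ.- + 5) ℤ.+ + 5
    k≡[k-5]+5 = ℤ-solve-∀
    10q+5 : ∀ q → q ℤ.* + 10 ℤ.+ + 5 ≡ (+ 1 ℤ.+ + 2 ℤ.* q) ℤ.* + 5
    10q+5 = ℤ-solve-∀
  exponent : ∀ {γ} j → γ ≡ fromℤ j → (k / 5) * γ ≡ fromℤ (m ℤ.* j)
  exponent j γ≡j = trans (cong₂ _*_ k/5≡m γ≡j) (fromℤ-* m j)
  even : ∀ M i → g M ≡ fromℤ (+ 2 ℤ.* i) → Ker (ν π k) M
  even M i eq = Ker-ν⇐even π cos-½π {k} {M} (m ℤ.* i)
    (trans (exponent (+ 2 ℤ.* i) eq) (cong fromℤ (swap m i)))
    where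
    swap : ∀ m i → m ℤ.* (+ 2 ℤ.* i) ≡ + 2 ℤ.* (m ℤ.* i)
    swap = ℤ-solve-∀
  odd : ∀ M i → g M ≡ fromℤ (+ 1 ℤ.+ + 2 ℤ.* i) → ¬ Ker (ν π k) M
  -- A product of odd numbers is odd: (1 + 2q)(1 + 2i) = 1 + 2(q + i + 2qi).
  odd M i eq = Ker-ν⇒¬odd π cos-½π {k} {M} (q ℤ.+ i ℤ.+ + 2 ℤ.* q ℤ.* i)
    (trans (exponent (+ 1 ℤ.+ + 2 ℤ.* i) eq) (cong fromℤ (odd*odd q i)))
    where
    odd*odd : ∀ q i → (+ 1 ℤ.+ + 2 ℤ.* q) ℤ.* (+ 1 ℤ.+ + 2 ℤ.* i) ≡
      + 1 ℤ.+ + 2 ℤ.* (q ℤ.+ i ℤ.+ + 2 ℤ.* q ℤ.* i)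
    odd*odd = ℤ-solve-∀
  to : ∀ M → Ker (ν π k) M → Diagonal (mat M)
  to M ν≈1 with parity-g M
  ... | inj₁ (diagonal , _) = diagonal
  ... | inj₂ (_ , i , eq)   = contradiction ν≈1 (odd M i eq)
  from : ∀ M → Diagonal (mat M) → Ker (ν π k) M
  from M diagonal with parity-g M
  ... | inj₁ (_ , i , eq) = even M i eq
  -- The stored class is ± S, which the assumed diagonal class excludes.
  ... | inj₂ (a≡0 , _)    = contradiction a≡0 (diagonal⇒a≢0 (mat M) diagonal)
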